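{- Let $n\ge1$. For all $\pi\in\mathcal S_n(321)$, \[\operatorname{sgn}(\rho_{\mathcal S}(\pi))=\operatorname{sgn}(\mathrm{LK}_{\mathcal S}(\pi))=\begin{cases}\operatorname{sgn}(\pi)&\text{if $n$ is odd,}\\-\operatorname{sgn}(\pi)&\text{if $n$ is even.}\end{cases}\]
   Context: $\operatorname{sgn}(\pi)=(-1)^{\mathrm{inv}(\pi)}$, where $\mathrm{inv}(\pi)=|\{(i,i'):i<i',\ \pi(i)>\pi(i')\}|$. $\mathcal S_n(321)$ is the set of permutations $\pi$ of $\{1,\dots,n\}$ that are $321$-avoiding: there are no $i<j<k$ with $\pi(i)>\pi(j)>\pi(k)$. $\mathbf A^{n-1}$ is the poset of intervals $\{[i,j]:1\le i\le j\le n-1\}$ ordered by inclusion, and $\mathcal A(\mathbf A^{n-1})$ is its set of antichains. Antichain rowmotion $\rho_{\mathcal A}$ sends an antichain $A$ to the set of minimal elements of the complement of the order ideal generated by $A$; it is a bijection. The map $\mathrm{Exc}:\mathcal S_n(321)\to\mathcal A(\mathbf A^{n-1})$, $\mathrm{Exc}(\pi)=\{[i,\pi(i)-1]:\pi(i)>i\}$, is a bijection. Rowmotion on $321$-avoiding permutations is $\rho_{\mathcal S}=\mathrm{Exc}^{ -1}\circ\rho_{\mathcal A}\circ\mathrm{Exc}$. Dyck paths: $\mathcal D_n$ is the set of words with $n$ letters $\mathtt u$ and $n$ letters $\mathtt d$ such that every prefix has at least as many $\mathtt u$'s as $\mathtt d$'s. A consecutive pair $\mathtt{ud}$ is a peak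 and a consecutive pair $\mathtt{du}$ is a valley. Words can be drawn as lattice paths from $(0,0)$ to $(n,n)$ in two ways: with $\mathtt u=(0,1),\mathtt d=(1,0)$ (path weakly above $y=x$), or with $\mathtt u=(1,0),\mathtt d=(0,1)$ (path weakly below $y=x$). In either drawing, a peak or valley consists of one horizontal step and one vertical step; it is said to occur at the cell $(i,j)$ if the horizontal step is in column $i$ (goes from $x=i-1$ to $x=i$) and the vertical step is in row $j$ (goes from $y=j-1$ to $y=j$). For $\pi\in\mathcal S_n(321)$, $E_p(\pi)\in\mathcal D_n$ is the path drawn above the diagonal whose peaks occur exactly at the cells $(i,\pi(i))$ with $\pi(i)\ge i$, and $D_v(\pi)\in\mathcal D_n$ is the path drawn below the diagonal whose valleys occur exactly at the cells $(i,\pi(i))$ with $\pi(i)<i$. Both $E_p,D_v:\mathcal S_n(321)\to\mathcal D_n$ are bijections. The Lalanne--Kreweras involution on $\mathcal D_n$ is $\mathrm{LK}=D_v\circ E_p^{ -1}$, and $\mathrm{LK}_{\mathcal S}=E_p^{ -1}\circ\mathrm{LK}\circ E_p:\mathcal S_n(321)\to\mathcal S_n(321)$. -}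

module Defs where

open import Data.Nat as ℕ using (ℕ; zero; suc; _+_; _∸_; _≤_; _<_; _>_; z≤n; s≤s)
open import Data.Nat.Properties as ℕₚ using (_≤?_; _<?_)
open import Data.Integer.Base as ℤ using (ℤ; -1ℤ)
open import Data.Fin.Base as Fin using (Fin; toℕ; fromℕ<)
import Data.Fin.Properties as Finₚ
open import Data.Fin.Permutation as Perm using (Permutation′; _⟨$⟩ʳ_; _⟨$⟩ˡ_)
open import Data.List.Base
  using (List; []; _∷_; _++_; length; filter; cartesianProduct; allFin; replicate; map)
import Data.List.Properties as Listₚ
open import Data.Product.Base using (Σ; ∃; ∃₂; _×_; _,_; proj₁; proj₂; uncurry)
open import Data.Sum.Base using (_⊎_; inj₁; inj₂)
open import Data.Empty using (⊥; ⊥-elim)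
open import Function.Base using (_∘_; id)
open import Function.Bundles using (Inverse; Equivalence; _⇔_; mk⇔)
open import Level using (0ℓ)
open import Relation.Binary.Bundles using (Setoid)
open import Relation.Binary.Definitions using (tri<; tri≈; tri>)
open import Relation.Binary.PropositionalEquality as ≡
  using (_≡_; _≢_; refl; sym; trans; cong; cong₂; subst; subst₂)
open import Relation.Nullary.Decidable as Dec using (Dec; yes; no; _×-dec_)
open import Relation.Nullary.Negation using (¬_; contradiction)
open import Relation.Unary using (Pred; Decidable; _∈_; ∁; _≐_)
open import Relation.Unary.Properties using (≐-refl; ≐-sym; ≐-trans)

-- Permutations of {1,…,n} are permutations of Fin n; the element of
-- {1,…,n} represented by i is ⟦ i ⟧.
⟦_⟧ : ∀ {n} → Fin n → ℕ
⟦ i ⟧ = suc (toℕ i)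

inv : ∀ {n} → Permutation′ n → ℕ
inv {n} π = length (filter
  (λ (i , i′) → (i Finₚ.<? i′) ×-dec (π ⟨$⟩ʳ i′ Finₚ.<? π ⟨$⟩ʳ i))
  (cartesianProduct (allFin n) (allFin n)))

Avoids321 : ∀ {n} → Permutation′ n → Set
Avoids321 π = ∀ {i j k} → i Fin.< j → j Fin.< k →
  ¬ (π ⟨$⟩ʳ i Fin.> π ⟨$⟩ʳ j × π ⟨$⟩ʳ j Fin.> π ⟨$⟩ʳ k)

record S321 (n : ℕ) : Set where
  constructor _avoiding_
  field
    perm   : Permutation′ n
    avoids : Avoids321 perm

open S321 public

infixl 5 _⟨$⟩_

_⟨$⟩_ : ∀ {n} → S321 n → Fin n → Fin n
π ⟨$⟩ i = perm π ⟨$⟩ʳ i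

S321-setoid : ℕ → Setoid 0ℓ 0ℓ
S321-setoid n = record
  { Carrier       = S321 n
  ; _≈_           = λ π σ → ∀ i → π ⟨$⟩ i ≡ σ ⟨$⟩ i
  ; isEquivalence = record
    { refl  = λ _ → refl
    ; sym   = λ p i → sym (p i)
    ; trans = λ p q i → trans (p i) (q i)
    }
  }

sgn : ∀ {n} → S321 n → ℤ
sgn π = -1ℤ ℤ.^ inv (perm π)

toℕ-cong-≢ : ∀ {n} {i j : Fin n} → i ≢ j → toℕ i ≢ toℕ j
toℕ-cong-≢ i≢j eq = i≢j (Finₚ.toℕ-injective eq)

perm-inj : ∀ {n} (σ : Permutation′ n) {i j} → σ ⟨$⟩ʳ i ≡ σ ⟨$⟩ʳ j → i ≡ j
perm-inj σ eq = trans (sym (Perm.inverseˡ σ)) (trans (cong (σ ⟨$⟩ˡ_) eq) (Perm.inverseˡ σ))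

perm-inj˘ : ∀ {n} (σ : Permutation′ n) {i j} → σ ⟨$⟩ˡ i ≡ σ ⟨$⟩ˡ j → i ≡ j
perm-inj˘ σ eq = trans (sym (Perm.inverseʳ σ)) (trans (cong (σ ⟨$⟩ʳ_) eq) (Perm.inverseʳ σ))

-- A weak excedance of a 321-avoiding permutation is a left-to-right maximum.
weakExc-increasing : ∀ {n} (σ : Permutation′ n) → Avoids321 σ → ∀ {i j} →
  i Fin.< j → j Fin.≤ σ ⟨$⟩ʳ j → σ ⟨$⟩ʳ i Fin.< σ ⟨$⟩ʳ j
weakExc-increasing {n} σ av {i} {j} i<j j≤σj with σ ⟨$⟩ʳ i Finₚ.<? σ ⟨$⟩ʳ j
... | yes p = p
... | no σi≮σj = ⊥-elim (collide (Finₚ.pigeonhole (s≤s j≤σj) g))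
  where
  σj<σi : σ ⟨$⟩ʳ j Fin.< σ ⟨$⟩ʳ i
  σj<σi = ℕₚ.≤∧≢⇒< (ℕₚ.≮⇒≥ σi≮σj)
    (toℕ-cong-≢ (λ eq → ℕₚ.<⇒≢ i<j (cong toℕ (sym (perm-inj σ eq)))))

  v<σj : (v : Fin.Fin′ (σ ⟨$⟩ʳ j)) → Fin.inject v Fin.< σ ⟨$⟩ʳ j
  v<σj v = subst (_< toℕ (σ ⟨$⟩ʳ j)) (sym (Finₚ.toℕ-inject v)) (Finₚ.toℕ<n v)

  pos<j : (v : Fin.Fin′ (σ ⟨$⟩ʳ j)) → σ ⟨$⟩ˡ Fin.inject v Fin.< j
  pos<j v = ℕₚ.≤∧≢⇒< (ℕₚ.≮⇒≥ ≯) (toℕ-cong-≢ ≠)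
    where
    ≯ : ¬ (j Fin.< σ ⟨$⟩ˡ Fin.inject v)
    ≯ lt = av i<j lt (σj<σi , subst (Fin._< σ ⟨$⟩ʳ j) (sym (Perm.inverseʳ σ)) (v<σj v))
    ≠ : σ ⟨$⟩ˡ Fin.inject v ≢ j
    ≠ eq = ℕₚ.<⇒≢ (v<σj v) (cong toℕ (trans (sym (Perm.inverseʳ σ)) (cong (σ ⟨$⟩ʳ_) eq)))

  g : Fin (suc (toℕ (σ ⟨$⟩ʳ j))) → Fin (toℕ j)
  g Fin.zero    = fromℕ< i<j
  g (Fin.suc v) = fromℕ< (pos<j v)

  g-val : ∀ {x y} (x<j : x Fin.< j) (y<j : y Fin.< j) → fromℕ< x<j ≡ fromℕ< y<j → x ≡ y
  g-val x<j y<j eq = Finₚ.toℕ-injective (Finₚ.fromℕ<-injective _ _ x<j y<j eq)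

  collide : ¬ ∃₂ λ a b → a Fin.< b × g a ≡ g b
  collide (Fin.zero , Fin.suc v , _ , eq) =
    ℕₚ.<-asym σj<σi (subst (Fin._< σ ⟨$⟩ʳ j)
      (sym (trans (cong (σ ⟨$⟩ʳ_) (g-val i<j (pos<j v) eq)) (Perm.inverseʳ σ))) (v<σj v))
  collide (Fin.suc v , Fin.suc w , s≤s v<w , eq) = ℕₚ.<⇒≢ v<w
    (trans (sym (Finₚ.toℕ-inject v)) (trans
      (cong toℕ (perm-inj˘ σ (g-val (pos<j v) (pos<j w) eq))) (Finₚ.toℕ-inject w)))

Avoids321-inverse : ∀ {n} (σ : Permutation′ n) → Avoids321 σ → Avoids321 (Perm.flip σ)
Avoids321-inverse σ av i<j j<k (p , q) = av q p
  ( subst₂ Fin._<_ (sym (Perm.inverseʳ σ)) (sym (Perm.inverseʳ σ)) j<k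
  , subst₂ Fin._<_ (sym (Perm.inverseʳ σ)) (sym (Perm.inverseʳ σ)) i<j )

-- Dually, a non-excedance is a right-to-left minimum.
nonExc-increasing : ∀ {n} (σ : Permutation′ n) → Avoids321 σ → ∀ {i j} →
  i Fin.< j → σ ⟨$⟩ʳ i Fin.≤ i → σ ⟨$⟩ʳ i Fin.< σ ⟨$⟩ʳ j
nonExc-increasing σ av {i} {j} i<j σi≤i with σ ⟨$⟩ʳ i Finₚ.<? σ ⟨$⟩ʳ j
... | yes p = p
... | no ≮ = contradiction i<j (ℕₚ.<-asym
  (subst₂ Fin._<_ (Perm.inverseˡ σ) (Perm.inverseˡ σ)
    (weakExc-increasing (Perm.flip σ) (Avoids321-inverse σ av) σj<σi
      (subst (σ ⟨$⟩ʳ i Fin.≤_) (sym (Perm.inverseˡ σ)) σi≤i))))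
  where
  σj<σi : σ ⟨$⟩ʳ j Fin.< σ ⟨$⟩ʳ i
  σj<σi = ℕₚ.≤∧≢⇒< (ℕₚ.≮⇒≥ ≮)
    (toℕ-cong-≢ (λ eq → ℕₚ.<⇒≢ i<j (cong toℕ (sym (perm-inj σ eq)))))

exc-determine : ∀ {n} (π σ : S321 n) →
  (∀ i → i Fin.< π ⟨$⟩ i → σ ⟨$⟩ i ≡ π ⟨$⟩ i) →
  (∀ i → i Fin.< σ ⟨$⟩ i → π ⟨$⟩ i ≡ σ ⟨$⟩ i) →
  ∀ i → π ⟨$⟩ i ≡ σ ⟨$⟩ i
exc-determine {n} π σ π⇒σ σ⇒π i = go (suc (toℕ i)) i ℕₚ.≤-refl
  where
  smaller : ∀ (α β : S321 n) i → (∀ k → k Fin.< i → α ⟨$⟩ k ≡ β ⟨$⟩ k) →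
    β ⟨$⟩ i Fin.≤ i → ¬ (α ⟨$⟩ i Fin.< β ⟨$⟩ i)
  smaller α β i ih βi≤i αi<βi with ℕₚ.<-cmp (toℕ (perm β ⟨$⟩ˡ (α ⟨$⟩ i))) (toℕ i)
  ... | tri< y<i _ _ = ℕₚ.<⇒≢ y<i (cong toℕ
          (perm-inj (perm α) (trans (ih _ y<i) (Perm.inverseʳ (perm β)))))
  ... | tri≈ _ y≡i _ = ℕₚ.<⇒≢ αi<βi (cong toℕ
          (trans (sym (Perm.inverseʳ (perm β))) (cong (β ⟨$⟩_) (Finₚ.toℕ-injective y≡i))))
  ... | tri> _ _ i<y = ℕₚ.<-asym αi<βi (subst (β ⟨$⟩ i Fin.<_) (Perm.inverseʳ (perm β))
          (nonExc-increasing (perm β) (avoids β) i<y βi≤i))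

  go : ∀ m i → toℕ i < m → π ⟨$⟩ i ≡ σ ⟨$⟩ i
  go (suc m) i (s≤s i≤m) with i Finₚ.<? π ⟨$⟩ i | i Finₚ.<? σ ⟨$⟩ i
  ... | yes p | _     = sym (π⇒σ i p)
  ... | no _  | yes p = σ⇒π i p
  ... | no p  | no q  with ℕₚ.<-cmp (toℕ (π ⟨$⟩ i)) (toℕ (σ ⟨$⟩ i))
  ... | tri< lt _ _ = contradiction lt (smaller π σ i (λ k k<i → go m k (ℕₚ.<-≤-trans k<i i≤m)) (ℕₚ.≮⇒≥ q))
  ... | tri≈ _ eq _ = Finₚ.toℕ-injective eq
  ... | tri> _ _ gt = contradiction gt (smaller σ π i (λ k k<i → sym (go m k (ℕₚ.<-≤-trans k<i i≤m))) (ℕₚ.≮⇒≥ p))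

-- Every i with π(i) < i lies under an arc z < i ≤ π(z).
covered : ∀ {n} (π : S321 n) {i} → π ⟨$⟩ i Fin.< i → ∃ λ z → z Fin.< i × i Fin.≤ π ⟨$⟩ z
covered {n} π {i} πi<i with Finₚ.any? (λ z → (z Finₚ.<? i) ×-dec (i Finₚ.≤? π ⟨$⟩ z))
... | yes p = p
... | no ¬p = ⊥-elim (collide (Finₚ.pigeonhole (ℕₚ.n<1+n (toℕ i)) g))
  where
  v<i : (v : Fin.Fin′ i) → Fin.inject v Fin.< i
  v<i v = subst (_< toℕ i) (sym (Finₚ.toℕ-inject v)) (Finₚ.toℕ<n v)

  πv<i : (v : Fin.Fin′ i) → π ⟨$⟩ Fin.inject v Fin.< i
  πv<i v = ℕₚ.≰⇒> (λ i≤ → ¬p (_ , v<i v , i≤))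

  g : Fin (suc (toℕ i)) → Fin (toℕ i)
  g Fin.zero    = fromℕ< πi<i
  g (Fin.suc v) = fromℕ< (πv<i v)

  g-val : ∀ {x y : Fin n} (x<i : π ⟨$⟩ x Fin.< i) (y<i : π ⟨$⟩ y Fin.< i) →
    fromℕ< x<i ≡ fromℕ< y<i → x ≡ y
  g-val x<i y<i eq = perm-inj (perm π)
    (Finₚ.toℕ-injective (Finₚ.fromℕ<-injective _ _ x<i y<i eq))

  collide : ¬ ∃₂ λ a b → a Fin.< b × g a ≡ g b
  collide (Fin.zero , Fin.suc v , _ , eq) =
    ℕₚ.<⇒≢ (v<i v) (cong toℕ (sym (g-val πi<i (πv<i v) eq)))
  collide (Fin.suc v , Fin.suc w , s≤s v<w , eq) = ℕₚ.<⇒≢ v<w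
    (trans (sym (Finₚ.toℕ-inject v)) (trans
      (cong toℕ (g-val (πv<i v) (πv<i w) eq)) (Finₚ.toℕ-inject w)))

-- The map sending m to j, x to x - 1 for m < x ≤ j, and fixing all else.
data Cycle (m j : ℕ) : ℕ → ℕ → Set where
  below : ∀ {x} → x < m → Cycle m j x x
  at    : Cycle m j m j
  mid   : ∀ {x} → m ≤ x → x < j → Cycle m j (suc x) x
  above : ∀ {x} → m < x → j < x → Cycle m j x x

cycle : ∀ m j x → ∃ (Cycle m j x)
cycle m j x with ℕₚ.<-cmp x m
... | tri< x<m _ _ = x , below x<m
... | tri≈ _ refl _ = j , at
cycle m j (suc x) | tri> _ _ (s≤s m≤x) with x <? j
... | yes x<j = x , mid m≤x x<j
... | no  x≮j = suc x , above (s≤s m≤x) (s≤s (ℕₚ.≮⇒≥ x≮j))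

cycle-mono : ∀ {m j x x′ y y′} → Cycle m j x y → Cycle m j x′ y′ →
  x ≢ m → x′ ≢ m → x < x′ → y < y′
cycle-mono at _ x≢m _ _ = contradiction refl x≢m
cycle-mono _ at _ x′≢m _ = contradiction refl x′≢m
cycle-mono (below p) (below q) _ _ lt = lt
cycle-mono (below p) (mid q _) _ _ lt = ℕₚ.<-≤-trans p q
cycle-mono (below p) (above q _) _ _ lt = lt
cycle-mono (mid p _) (below q) _ _ lt =
  contradiction (ℕₚ.<-trans (ℕₚ.<-trans (s≤s p) lt) q) (ℕₚ.<-irrefl refl)
cycle-mono (mid p _) (mid q _) _ _ (s≤s lt) = lt
cycle-mono (mid p _) (above q _) _ _ lt = ℕₚ.<-trans (ℕₚ.n<1+n _) lt
cycle-mono (above p _) (below q) _ _ lt =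
  contradiction (ℕₚ.<-trans (ℕₚ.<-trans p lt) q) (ℕₚ.<-irrefl refl)
cycle-mono (above _ p) (mid _ q) _ _ lt =
  contradiction (ℕₚ.<-≤-trans (ℕₚ.<-trans p lt) q) (ℕₚ.<-irrefl refl)
cycle-mono (above p _) (above q _) _ _ lt = lt

cycle-at : ∀ {m j y} → m ≤ j → Cycle m j m y → y ≡ j
cycle-at _ (below p) = contradiction p (ℕₚ.<-irrefl refl)
cycle-at _ at = refl
cycle-at _ (mid p _) = contradiction p (ℕₚ.<-irrefl refl)
cycle-at _ (above p _) = contradiction p (ℕₚ.<-irrefl refl)

cycle-≢j : ∀ {m j x y} → m ≤ j → Cycle m j x y → x ≢ m → y ≢ j
cycle-≢j m≤j (below p) _ refl = contradiction (ℕₚ.<-≤-trans p m≤j) (ℕₚ.<-irrefl refl)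
cycle-≢j _ at x≢m _ = x≢m refl
cycle-≢j _ (mid _ q) _ refl = contradiction q (ℕₚ.<-irrefl refl)
cycle-≢j _ (above _ q) _ refl = contradiction q (ℕₚ.<-irrefl refl)

cycle-inj : ∀ {m j x x′ y} → m ≤ j → Cycle m j x y → Cycle m j x′ y → x ≡ x′
cycle-inj {m} {j} {x} {x′} m≤j c c′ with x ℕₚ.≟ m | x′ ℕₚ.≟ m
... | yes refl | yes refl = refl
... | yes refl | no x′≢m  = contradiction (cycle-at m≤j c) (cycle-≢j m≤j c′ x′≢m)
... | no x≢m  | yes refl  = contradiction (cycle-at m≤j c′) (cycle-≢j m≤j c x≢m)
... | no x≢m  | no x′≢m with ℕₚ.<-cmp x x′
... | tri< lt _ _ = contradiction (cycle-mono c c′ x≢m x′≢m lt) (ℕₚ.<-irrefl refl)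
... | tri≈ _ eq _ = eq
... | tri> _ _ gt = contradiction (cycle-mono c′ c x′≢m x≢m gt) (ℕₚ.<-irrefl refl)

cycle-bound : ∀ {m j x y n} → Cycle m j x y → x < n → j < n → y < n
cycle-bound (below _) x<n _ = x<n
cycle-bound at _ j<n = j<n
cycle-bound (mid _ _) x<n _ = ℕₚ.<-trans (ℕₚ.n<1+n _) x<n
cycle-bound (above _ _) x<n _ = x<n

injective⇒permutation : ∀ {n} (f : Fin n → Fin n) → (∀ {x y} → f x ≡ f y → x ≡ y) →
  Σ (Permutation′ n) λ π → ∀ x → π ⟨$⟩ʳ x ≡ f x
injective⇒permutation {zero}  f inj = Perm.id , λ ()
injective⇒permutation {suc n} f inj =
  Perm.permutation f (proj₁ ∘ preimage) (proj₂ ∘ preimage)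
    (λ x → inj (proj₂ (preimage (f x)))) , λ _ → refl
  where
  preimage : ∀ y → ∃ λ x → f x ≡ y
  preimage y with Finₚ.any? (λ x → f x Finₚ.≟ y)
  ... | yes p = p
  ... | no ¬p = contradiction
    (Finₚ.injective⇒≤ {f = λ x → Fin.punchOut (λ eq → ¬p (x , sym eq))}
      (λ {a} {b} eq → inj (Finₚ.punchOut-injective
        (λ e → ¬p (a , sym e)) (λ e → ¬p (b , sym e)) eq)))
    ℕₚ.1+n≰n

-- R is the graph of a partial function with i ≤ R(i) < n, strictly increasing
-- on its domain.
module Fill {n : ℕ} (R : ℕ → ℕ → Set) (R? : ∀ i → Dec (∃ (R i)))
  (R-≤ : ∀ {i j} → R i j → i ≤ j) (R-< : ∀ {i j} → R i j → j < n)
  (R-functional : ∀ {i j j′} → R i j → R i j′ → j ≡ j′)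
  (R-increasing : ∀ {i j i′ j′} → R i j → R i′ j′ → i < i′ → j < j′)
  where

  private
    Dom : ℕ → ℕ → Set
    Dom m x = x < m × ∃ (R x)

    record Stage (m : ℕ) : Set where
      field
        f      : ℕ → ℕ
        bound  : ∀ {x} → x < n → f x < n
        inj    : ∀ {x y} → f x ≡ f y → x ≡ y
        hit    : ∀ {i j} → i < m → R i j → f i ≡ j
        low    : ∀ {x} → ¬ Dom m x → f x ≤ x
        strict : ∀ {x i j} → ¬ Dom m x → i < m → R i j → i < x → x ≤ j → f x < x
        fixed  : ∀ {x} → (∀ {i j} → i < m → R i j → j < x) → f x ≡ x
        mono   : ∀ {x y} → ¬ Dom m x → ¬ Dom m y → x < y → f x < f y

    stage : ∀ m → Stage m
    stage zero = record
      { f      = id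
      ; bound  = id
      ; inj    = id
      ; hit    = λ ()
      ; low    = λ _ → ℕₚ.≤-refl
      ; strict = λ _ ()
      ; fixed  = λ _ → refl
      ; mono   = λ _ _ → id
      }
    stage (suc m) with R? m
    ... | no ∄j = record
      { f      = f
      ; bound  = bound
      ; inj    = inj
      ; hit    = λ i<1+m r → hit (shrink i<1+m r) r
      ; low    = λ ¬d → low (¬d ∘ grow)
      ; strict = λ ¬d i<1+m r → strict (¬d ∘ grow) (shrink i<1+m r) r
      ; fixed  = λ big → fixed (λ i<m → big (ℕₚ.<-trans i<m (ℕₚ.n<1+n _)))
      ; mono   = λ ¬d ¬d′ → mono (¬d ∘ grow) (¬d′ ∘ grow)
      }
      where
      open Stage (stage m)
      shrink : ∀ {i j} → i < suc m → R i j → i < m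
      shrink (s≤s i≤m) r = ℕₚ.≤∧≢⇒< i≤m (λ { refl → ∄j (_ , r) })
      grow : ∀ {x} → Dom m x → Dom (suc m) x
      grow (x<m , d) = ℕₚ.<-trans x<m (ℕₚ.n<1+n _) , d
    ... | yes (j , mRj) = record
      { f      = f ∘ c
      ; bound  = λ {x} x<n → bound (cycle-bound (proj₂ (cycle m j x)) x<n (R-< mRj))
      ; inj    = λ {x} {y} eq → cycle-inj m≤j
                   (subst (Cycle m j x) (inj eq) (proj₂ (cycle m j x))) (proj₂ (cycle m j y))
      ; hit    = λ {i} i<1+m r → hit′ i<1+m r (proj₂ (cycle m j i))
      ; low    = λ {x} ¬d → low′ ¬d (proj₂ (cycle m j x))
      ; strict = λ {x} ¬d i<1+m r i<x x≤j → strict′ ¬d i<1+m r i<x x≤j (proj₂ (cycle m j x))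
      ; fixed  = λ {x} big → fixed′ big (proj₂ (cycle m j x))
      ; mono   = λ {x} {y} ¬d ¬d′ x<y → mono
                   (keep ¬d (proj₂ (cycle m j x))) (keep ¬d′ (proj₂ (cycle m j y)))
                   (cycle-mono (proj₂ (cycle m j x)) (proj₂ (cycle m j y)) (≢m ¬d) (≢m ¬d′) x<y)
      }
      where
      open Stage (stage m)
      m≤j = R-≤ mRj
      c : ℕ → ℕ
      c x = proj₁ (cycle m j x)
      j-max : ∀ {i k} → i < suc m → R i k → k ≤ j
      j-max {i} (s≤s i≤m) r with i ℕₚ.≟ m
      ... | yes refl = ℕₚ.≤-reflexive (R-functional r mRj)
      ... | no  i≢m  = ℕₚ.<⇒≤ (R-increasing r mRj (ℕₚ.≤∧≢⇒< i≤m i≢m))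
      fixed≥ : ∀ {x} → j ≤ x → f x ≡ x
      fixed≥ j≤x = fixed (λ i<m r → ℕₚ.<-≤-trans (R-increasing r mRj i<m) j≤x)
      grow : ∀ {x} → Dom m x → Dom (suc m) x
      grow (x<m , d) = ℕₚ.<-trans x<m (ℕₚ.n<1+n _) , d
      ≢m : ∀ {x} → ¬ Dom (suc m) x → x ≢ m
      ≢m ¬d refl = ¬d (ℕₚ.n<1+n _ , j , mRj)
      low≥ : ∀ {x} → m ≤ x → f x ≤ x
      low≥ m≤x = low (λ (x<m , _) → ℕₚ.≤⇒≯ m≤x x<m)
      keep : ∀ {x y} → ¬ Dom (suc m) x → Cycle m j x y → ¬ Dom m y
      keep ¬d (below _) d = ¬d (grow d)
      keep ¬d at _ = ¬d (ℕₚ.n<1+n _ , j , mRj)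
      keep ¬d (mid m≤y _) (y<m , _) = ℕₚ.≤⇒≯ m≤y y<m
      keep ¬d (above m<y _) (y<m , _) = ℕₚ.<-asym m<y y<m
      hit′ : ∀ {i k y} → i < suc m → R i k → Cycle m j i y → f y ≡ k
      hit′ _ r (below i<m) = hit i<m r
      hit′ _ r at = trans (fixed≥ ℕₚ.≤-refl) (R-functional mRj r)
      hit′ (s≤s x<m) _ (mid m≤x _) = contradiction m≤x (ℕₚ.<⇒≱ x<m)
      hit′ (s≤s i≤m) _ (above m<i _) = contradiction m<i (ℕₚ.≤⇒≯ i≤m)
      low′ : ∀ {x y} → ¬ Dom (suc m) x → Cycle m j x y → f y ≤ x
      low′ ¬d (below x<m) = low (¬d ∘ grow)
      low′ ¬d at = contradiction refl (≢m ¬d)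
      low′ ¬d (mid m≤y _) = ℕₚ.m≤n⇒m≤1+n (low≥ m≤y)
      low′ ¬d (above _ j<x) = ℕₚ.≤-reflexive (fixed≥ (ℕₚ.<⇒≤ j<x))
      strict′ : ∀ {x i k y} → ¬ Dom (suc m) x → i < suc m → R i k → i < x → x ≤ k →
        Cycle m j x y → f y < x
      strict′ ¬d _ r i<x x≤k (below x<m) =
        strict (¬d ∘ grow) (ℕₚ.<-trans i<x x<m) r i<x x≤k
      strict′ ¬d _ _ _ _ at = contradiction refl (≢m ¬d)
      strict′ ¬d _ _ _ _ (mid m≤y _) = s≤s (low≥ m≤y)
      strict′ ¬d i<1+m r _ x≤k (above _ j<x) =
        contradiction (ℕₚ.<-≤-trans j<x x≤k) (ℕₚ.≤⇒≯ (j-max i<1+m r))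
      fixed′ : ∀ {x y} → (∀ {i k} → i < suc m → R i k → k < x) → Cycle m j x y → f y ≡ x
      fixed′ big (below x<m) =
        contradiction (ℕₚ.<-≤-trans x<m m≤j) (ℕₚ.<-asym (big (ℕₚ.n<1+n _) mRj))
      fixed′ big at = contradiction (big (ℕₚ.n<1+n _) mRj) (ℕₚ.≤⇒≯ m≤j)
      fixed′ big (mid _ y<j) = contradiction (big (ℕₚ.n<1+n _) mRj) (ℕₚ.≤⇒≯ y<j)
      fixed′ big (above _ j<x) = fixed≥ (ℕₚ.<⇒≤ j<x)

    open Stage (stage n)

    in-dom : ∀ {i j} → R i j → i < n
    in-dom r = ℕₚ.≤-<-trans (R-≤ r) (R-< r)

    g : Fin n → Fin n
    g x = fromℕ< (bound (Finₚ.toℕ<n x))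

    toℕ-g : ∀ x → toℕ (g x) ≡ f (toℕ x)
    toℕ-g x = Finₚ.toℕ-fromℕ< (bound (Finₚ.toℕ<n x))

    π-spec : Σ (Permutation′ n) λ π → ∀ x → π ⟨$⟩ʳ x ≡ g x
    π-spec = injective⇒permutation g (λ {x} {y} eq → Finₚ.toℕ-injective
      (inj (trans (sym (toℕ-g x)) (trans (cong toℕ eq) (toℕ-g y)))))

    toℕ-π : ∀ x → toℕ (proj₁ π-spec ⟨$⟩ʳ x) ≡ f (toℕ x)
    toℕ-π x = trans (cong toℕ (proj₂ π-spec x)) (toℕ-g x)

    no-descent : ∀ {x y} → ¬ ∃ (R x) → ¬ ∃ (R y) → x < y → ¬ (f y < f x)
    no-descent ¬d ¬d′ x<y = ℕₚ.<-asym (mono (¬d ∘ proj₂) (¬d′ ∘ proj₂) x<y)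

    no-descent′ : ∀ {x y} → ∃ (R x) → ∃ (R y) → x < y → ¬ (f y < f x)
    no-descent′ (_ , r) (_ , r′) x<y = ℕₚ.<-asym
      (subst₂ _<_ (sym (hit (in-dom r) r)) (sym (hit (in-dom r′) r′)) (R-increasing r r′ x<y))

    avoid : ∀ {x y z} → x < y → y < z → f y < f x → f z < f y → ⊥
    avoid {x} {y} {z} x<y y<z p q with R? x | R? y | R? z
    ... | yes a | yes b | _     = no-descent′ a b x<y p
    ... | no a  | no b  | _     = no-descent a b x<y p
    ... | _     | yes b | yes c = no-descent′ b c y<z q
    ... | _     | no b  | no c  = no-descent b c y<z q
    ... | yes a | no _  | yes c = no-descent′ a c (ℕₚ.<-trans x<y y<z) (ℕₚ.<-trans q p)
    ... | no a  | yes _ | no c  = no-descent a c (ℕₚ.<-trans x<y y<z) (ℕₚ.<-trans q p)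

  filling : S321 n
  filling = proj₁ π-spec avoiding λ {i} {j} {k} i<j j<k (p , q) →
    avoid i<j j<k (subst₂ _<_ (toℕ-π j) (toℕ-π i) p) (subst₂ _<_ (toℕ-π k) (toℕ-π j) q)

  filling-hit : ∀ {i j} → R (toℕ i) j → toℕ (filling ⟨$⟩ i) ≡ j
  filling-hit {i} r = trans (toℕ-π i) (hit (Finₚ.toℕ<n i) r)

  filling-low : ∀ {i} → ¬ ∃ (R (toℕ i)) → filling ⟨$⟩ i Fin.≤ i
  filling-low {i} ¬r = subst (_≤ toℕ i) (sym (toℕ-π i)) (low (¬r ∘ proj₂))

  filling-strict : ∀ {i z j} → ¬ ∃ (R (toℕ i)) → R z j → z < toℕ i → toℕ i ≤ j →
    filling ⟨$⟩ i Fin.< i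
  filling-strict {i} ¬r r z<i i≤j = subst (_< toℕ i) (sym (toℕ-π i))
    (strict (¬r ∘ proj₂) (in-dom r) r z<i i≤j)

record Interval (n : ℕ) : Set where
  constructor interval
  field
    lo hi   : ℕ
    1≤lo    : 1 ≤ lo
    lo≤hi   : lo ≤ hi
    hi≤n-1  : hi ≤ n ∸ 1

open Interval public

infix 4 _⊑_

_⊑_ : ∀ {n} → Interval n → Interval n → Set
I ⊑ J = lo J ≤ lo I × hi I ≤ hi J

IsAntichain : ∀ {n} → Pred (Interval n) 0ℓ → Set
IsAntichain P = ∀ {I J} → I ∈ P → J ∈ P → I ⊑ J → I ≡ J

-- Sets of intervals are finite, so they are encoded as decidable predicates and
-- compared extensionally.
record Antichain (n : ℕ) : Set₁ where
  field
    member    : Pred (Interval n) 0ℓ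
    member?   : Decidable member
    antichain : IsAntichain member

open Antichain public

Antichain-setoid : ℕ → Setoid (Level.suc 0ℓ) 0ℓ
Antichain-setoid n = record
  { Carrier       = Antichain n
  ; _≈_           = λ A B → member A ≐ member B
  ; isEquivalence = record
    { refl  = λ {A} → ≐-refl {x = member A}
    ; sym   = λ {A B} → ≐-sym {x = member A} {y = member B}
    ; trans = λ {A B C} → ≐-trans {i = member A} {j = member B} {k = member C}
    }
  }

OrderIdeal : ∀ {n} → Pred (Interval n) 0ℓ → Pred (Interval n) 0ℓ
OrderIdeal P I = ∃ λ J → J ∈ P × I ⊑ J

Minimal : ∀ {n} → Pred (Interval n) 0ℓ → Pred (Interval n) 0ℓ
Minimal P I = I ∈ P × (∀ J → J ∈ P → J ⊑ I → J ≡ I)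

Interval-≡ : ∀ {n} {I J : Interval n} → lo I ≡ lo J → hi I ≡ hi J → I ≡ J
Interval-≡ {I = interval l h p q r} {J = interval l h p′ q′ r′} refl refl
  rewrite ℕₚ.≤-irrelevant p p′ | ℕₚ.≤-irrelevant q q′ | ℕₚ.≤-irrelevant r r′ = refl

⊑-antisym : ∀ {n} {I J : Interval n} → I ⊑ J → J ⊑ I → I ≡ J
⊑-antisym (p , q) (p′ , q′) = Interval-≡ (ℕₚ.≤-antisym p′ p) (ℕₚ.≤-antisym q q′)

_⊑?_ : ∀ {n} (I J : Interval n) → Dec (I ⊑ J)
I ⊑? J = (lo J ≤? lo I) ×-dec (hi I ≤? hi J)

_≟ᴵ_ : ∀ {n} (I J : Interval n) → Dec (I ≡ J)
I ≟ᴵ J = Dec.map′ (uncurry Interval-≡) (λ { refl → refl , refl })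
  ((lo I ℕₚ.≟ lo J) ×-dec (hi I ℕₚ.≟ hi J))

hi<n : ∀ {n} (I : Interval n) → hi I < n
hi<n {suc n} I = s≤s (hi≤n-1 I)
hi<n {zero}  I = contradiction (ℕₚ.≤-trans (ℕₚ.≤-trans (1≤lo I) (lo≤hi I)) (hi≤n-1 I)) λ ()

lo<n : ∀ {n} (I : Interval n) → lo I < n
lo<n I = ℕₚ.≤-<-trans (lo≤hi I) (hi<n I)

anyInterval? : ∀ {n} {P : Pred (Interval n) 0ℓ} → Decidable P → Dec (∃ P)
anyInterval? {n} {P} P? = Dec.map′
  (λ (_ , _ , I , _ , _ , p) → I , p)
  (λ (I , p) → fromℕ< (lo<n I) , fromℕ< (hi<n I) , I
    , sym (Finₚ.toℕ-fromℕ< (lo<n I)) , sym (Finₚ.toℕ-fromℕ< (hi<n I)) , p)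
  (Finₚ.any? λ a → Finₚ.any? λ b → ends? (toℕ a) (toℕ b))
  where
  ends? : ∀ a b → Dec (∃ λ I → lo I ≡ a × hi I ≡ b × P I)
  ends? a b with 1 ≤? a | a ≤? b | b ≤? n ∸ 1
  ... | yes p | yes q | yes r = Dec.map′ (λ x → interval a b p q r , refl , refl , x)
    (λ (_ , a≡ , b≡ , x) → subst P (Interval-≡ a≡ b≡) x) (P? (interval a b p q r))
  ... | no ¬p | _     | _     = no λ { (I , refl , refl , _) → ¬p (1≤lo I) }
  ... | yes _ | no ¬q | _     = no λ { (I , refl , refl , _) → ¬q (lo≤hi I) }
  ... | yes _ | yes _ | no ¬r = no λ { (I , refl , refl , _) → ¬r (hi≤n-1 I) }

OrderIdeal? : ∀ {n} {P : Pred (Interval n) 0ℓ} → Decidable P → Decidable (OrderIdeal P)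
OrderIdeal? P? I = anyInterval? λ J → P? J ×-dec (I ⊑? J)

Minimal? : ∀ {n} {P : Pred (Interval n) 0ℓ} → Decidable P → Decidable (Minimal P)
Minimal? {P = P} P? I = P? I ×-dec Dec.map′
  (λ ∄ J J∈P J⊑I → Dec.decidable-stable (J ≟ᴵ I) (λ J≢I → ∄ (J , J∈P , J⊑I , J≢I)))
  (λ min (J , J∈P , J⊑I , J≢I) → J≢I (min J J∈P J⊑I))
  (Dec.¬? (anyInterval? λ J → P? J ×-dec (J ⊑? I) ×-dec Dec.¬? (J ≟ᴵ I)))

ρ𝓐 : ∀ {n} → Antichain n → Antichain n
ρ𝓐 A = record
  { member    = Minimal (∁ (OrderIdeal (member A)))
  ; member?   = Minimal? (λ I → Dec.¬? (OrderIdeal? (member? A) I))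
  ; antichain = λ {I} I∈ J∈ I⊑J → proj₂ J∈ I (proj₁ I∈) I⊑J
  }

Exc : ∀ {n} → S321 n → Antichain n
Exc {n} π = record
  { member    = member′
  ; member?   = λ I → Finₚ.any? λ i → (⟦ i ⟧ <? ⟦ π ⟨$⟩ i ⟧)
                  ×-dec (lo I ℕₚ.≟ ⟦ i ⟧) ×-dec (hi I ℕₚ.≟ ⟦ π ⟨$⟩ i ⟧ ∸ 1)
  ; antichain = incomparable
  }
  where
  member′ : Pred (Interval n) 0ℓ
  member′ I = ∃ λ i → ⟦ π ⟨$⟩ i ⟧ > ⟦ i ⟧ × lo I ≡ ⟦ i ⟧ × hi I ≡ ⟦ π ⟨$⟩ i ⟧ ∸ 1

  incomparable : IsAntichain member′
  incomparable {I} {J} (i , s≤s i<πi , lo≡ , hi≡) (i′ , _ , lo≡′ , hi≡′) (lo≤ , hi≤)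
    with ℕₚ.m≤n⇒m<n∨m≡n (ℕ.s≤s⁻¹ (subst₂ _≤_ lo≡′ lo≡ lo≤))
  ... | inj₁ i′<i = contradiction (subst₂ _≤_ hi≡ hi≡′ hi≤)
          (ℕₚ.<⇒≱ (weakExc-increasing (perm π) (avoids π) i′<i (ℕₚ.<⇒≤ i<πi)))
  ... | inj₂ i′≡i with refl ← Finₚ.toℕ-injective i′≡i =
          Interval-≡ (trans lo≡ (sym lo≡′)) (trans hi≡ (sym hi≡′))

inverseOf : ∀ {a ℓ b ℓ′} (S : Setoid a ℓ) (T : Setoid b ℓ′) →
  let open Setoid S renaming (Carrier to A; _≈_ to _≈₁_)
      open Setoid T renaming (Carrier to B; _≈_ to _≈₂_) in
  (to : A → B) → (∀ {x y} → x ≈₁ y → to x ≈₂ to y) →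
  (∀ x y → to x ≈₂ to y → x ≈₁ y) →
  (from : B → A) → (∀ y → to (from y) ≈₂ y) → Inverse S T
inverseOf S T to to-cong to-inj from to∘from = record
  { to        = to
  ; from      = from
  ; to-cong   = to-cong
  ; from-cong = λ {x y} x≈y → to-inj _ _
      (T.trans (to∘from x) (T.trans x≈y (T.sym (to∘from y))))
  ; inverse   = (λ {x} y≈ → T.trans (to-cong y≈) (to∘from x))
              , (λ {x} {y} y≈ → to-inj _ _ (T.trans (to∘from y) y≈))
  }
  where module T = Setoid T

module Exc⁻ {n} (A : Antichain n) where
  R : ℕ → ℕ → Set
  R i j = ∃ λ I → I ∈ member A × lo I ≡ suc i × hi I ≡ j

  R? : ∀ i → Dec (∃ (R i))
  R? i = Dec.map′ (λ (I , I∈ , l) → hi I , I , I∈ , l , refl) (λ (_ , I , I∈ , l , _) → I , I∈ , l)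
    (anyInterval? λ I → member? A I ×-dec (lo I ℕₚ.≟ suc i))

  R-≤ : ∀ {i j} → R i j → i ≤ j
  R-≤ (I , _ , lo≡ , refl) = ℕₚ.<⇒≤ (subst (_≤ hi I) lo≡ (lo≤hi I))

  R-< : ∀ {i j} → R i j → j < n
  R-< (I , _ , _ , refl) = hi<n I

  R-functional : ∀ {i j j′} → R i j → R i j′ → j ≡ j′
  R-functional (I , I∈ , l , refl) (J , J∈ , l′ , refl) with ℕₚ.≤-total (hi I) (hi J)
  ... | inj₁ h = cong hi (antichain A I∈ J∈ (ℕₚ.≤-reflexive (trans l′ (sym l)) , h))
  ... | inj₂ h = cong hi (sym (antichain A J∈ I∈ (ℕₚ.≤-reflexive (trans l (sym l′)) , h)))

  R-increasing : ∀ {i j i′ j′} → R i j → R i′ j′ → i < i′ → j < j′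
  R-increasing (I , I∈ , l , refl) (J , J∈ , l′ , refl) i<i′ with hi I <? hi J
  ... | yes p = p
  ... | no ≮ = contradiction
    (cong lo (antichain A J∈ I∈ (ℕₚ.<⇒≤ lt , ℕₚ.≮⇒≥ ≮))) (ℕₚ.<⇒≢ lt ∘ sym)
    where lt = subst₂ _<_ (sym l) (sym l′) (s≤s i<i′)

  open Fill R R? R-≤ R-< R-functional R-increasing public

  Exc-filling : member (Exc filling) ≐ member A
  Exc-filling = to , from
    where
    to : ∀ {I} → I ∈ member (Exc filling) → I ∈ member A
    to {I} (i , s≤s i<π , l , h) with R? (toℕ i)
    ... | no ¬r = contradiction (filling-low ¬r) (ℕₚ.<⇒≱ i<π)
    ... | yes (_ , r@(J , J∈ , l′ , h′)) = subst (member A)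
            (Interval-≡ (trans l′ (sym l)) (trans h′ (trans (sym (filling-hit r)) (sym h)))) J∈
    from : ∀ {I} → I ∈ member A → I ∈ member (Exc filling)
    from {interval (suc k) b p q r} I∈ =
      i , s≤s (subst₂ _<_ (sym i≡) (sym πi≡) q) , cong suc (sym i≡) , sym πi≡
      where
      k<n = ℕₚ.<-trans (ℕₚ.n<1+n k) (lo<n (interval (suc k) b p q r))
      i   = fromℕ< k<n
      i≡  = Finₚ.toℕ-fromℕ< k<n
      πi≡ = filling-hit {i} (interval (suc k) b p q r , I∈ , cong suc (sym i≡) , refl)

Exc-cong : ∀ {n} {π σ : S321 n} → (∀ i → π ⟨$⟩ i ≡ σ ⟨$⟩ i) → member (Exc π) ≐ member (Exc σ)
Exc-cong {π = π} {σ} eq = (λ {I} → half π σ eq {I}) , (λ {I} → half σ π (sym ∘ eq) {I})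
  where
  half : ∀ (α β : S321 _) → (∀ i → α ⟨$⟩ i ≡ β ⟨$⟩ i) →
    ∀ {I} → I ∈ member (Exc α) → I ∈ member (Exc β)
  half α β eq (i , p , l , h) =
    i , subst (λ x → ⟦ x ⟧ > ⟦ i ⟧) (eq i) p , l , trans h (cong toℕ (eq i))

Exc-injective : ∀ {n} (π σ : S321 n) → member (Exc π) ≐ member (Exc σ) → ∀ i → π ⟨$⟩ i ≡ σ ⟨$⟩ i
Exc-injective {n} π σ (π⊆σ , σ⊆π) = exc-determine π σ (half π σ (λ {I} → π⊆σ {I})) (half σ π (λ {I} → σ⊆π {I}))
  where
  half : ∀ (α β : S321 n) → (∀ {I} → I ∈ member (Exc α) → I ∈ member (Exc β)) →
    ∀ i → i Fin.< α ⟨$⟩ i → β ⟨$⟩ i ≡ α ⟨$⟩ i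
  half α β α⊆β i i<αi with α⊆β {interval ⟦ i ⟧ (toℕ (α ⟨$⟩ i)) (s≤s z≤n) i<αi
    (ℕₚ.<⇒≤pred (Finₚ.toℕ<n (α ⟨$⟩ i)))} (i , s≤s i<αi , refl , refl)
  ... | i′ , _ , l , h with refl ← Finₚ.toℕ-injective (ℕₚ.suc-injective l) =
        Finₚ.toℕ-injective (sym h)

Exc-bijection : ∀ n → Inverse (S321-setoid n) (Antichain-setoid n)
Exc-bijection n = inverseOf (S321-setoid n) (Antichain-setoid n)
  Exc (λ {π σ} → Exc-cong {π = π} {σ}) Exc-injective Exc⁻.filling Exc⁻.Exc-filling

Exc⁻¹ : ∀ {n} → Antichain n → S321 n
Exc⁻¹ = Inverse.from (Exc-bijection _)

ρ𝓢 : ∀ {n} → S321 n → S321 n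
ρ𝓢 = Exc⁻¹ ∘ ρ𝓐 ∘ Exc

data Letter : Set where
  𝚞 𝚍 : Letter

Word : Set
Word = List Letter

infix 4 _≟_

_≟_ : (a b : Letter) → Dec (a ≡ b)
𝚞 ≟ 𝚞 = yes refl
𝚞 ≟ 𝚍 = no λ ()
𝚍 ≟ 𝚞 = no λ ()
𝚍 ≟ 𝚍 = yes refl

# : Letter → Word → ℕ
# a w = length (filter (a ≟_) w)

record Dyck (n : ℕ) : Set where
  field
    word   : Word
    #𝚞     : # 𝚞 word ≡ n
    #𝚍     : # 𝚍 word ≡ n
    prefix : ∀ p s → word ≡ p ++ s → # 𝚍 p ≤ # 𝚞 p

open Dyck public

Dyck-setoid : ℕ → Setoid 0ℓ 0ℓ
Dyck-setoid n = record
  { Carrier       = Dyck n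
  ; _≈_           = λ D E → word D ≡ word E
  ; isEquivalence = record { refl = refl ; sym = sym ; trans = trans }
  }

-- A peak at the cell (i , j) when 𝚞 = (0,1) and 𝚍 = (1,0): the path reaches
-- the point (# 𝚍 p , # 𝚞 p) after the prefix p.
PeakAbove : Word → ℕ → ℕ → Set
PeakAbove w i j = ∃₂ λ p s → w ≡ p ++ 𝚞 ∷ 𝚍 ∷ s × i ≡ suc (# 𝚍 p) × j ≡ suc (# 𝚞 p)

-- A valley at the cell (i , j) when 𝚞 = (1,0) and 𝚍 = (0,1): the path reaches
-- the point (# 𝚞 p , # 𝚍 p) after the prefix p.
ValleyBelow : Word → ℕ → ℕ → Set
ValleyBelow w i j = ∃₂ λ p s → w ≡ p ++ 𝚍 ∷ 𝚞 ∷ s × i ≡ suc (# 𝚞 p) × j ≡ suc (# 𝚍 p)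

-- The properties that characterise E_p(π) and D_v(π); existence and uniqueness of
-- these paths are proved with E-p and D-v below.
PeaksAtWeakExcedances : ∀ {n} → S321 n → Dyck n → Set
PeaksAtWeakExcedances π D = ∀ i j → PeakAbove (word D) i j ⇔
  (∃ λ k → i ≡ ⟦ k ⟧ × j ≡ ⟦ π ⟨$⟩ k ⟧ × ⟦ k ⟧ ≤ ⟦ π ⟨$⟩ k ⟧)

ValleysAtAntiExcedances : ∀ {n} → S321 n → Dyck n → Set
ValleysAtAntiExcedances π D = ∀ i j → ValleyBelow (word D) i j ⇔
  (∃ λ k → i ≡ ⟦ k ⟧ × j ≡ ⟦ π ⟨$⟩ k ⟧ × ⟦ π ⟨$⟩ k ⟧ < ⟦ k ⟧)

-- Peaks of a path starting at the point (a , b), in the drawing above the diagonal.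
data Corner : Word → ℕ → ℕ → ℕ → ℕ → Set where
  here   : ∀ {w a b} → Corner (𝚞 ∷ 𝚍 ∷ w) a b (suc a) (suc b)
  skip-𝚞 : ∀ {w a b i j} → Corner w a (suc b) i j → Corner (𝚞 ∷ w) a b i j
  skip-𝚍 : ∀ {w a b i j} → Corner w (suc a) b i j → Corner (𝚍 ∷ w) a b i j

Corner⇒split : ∀ {w a b i j} → Corner w a b i j →
  ∃₂ λ p s → w ≡ p ++ 𝚞 ∷ 𝚍 ∷ s × i ≡ suc (a + # 𝚍 p) × j ≡ suc (b + # 𝚞 p)
Corner⇒split {a = a} {b} here =
  [] , _ , refl , cong suc (sym (ℕₚ.+-identityʳ a)) , cong suc (sym (ℕₚ.+-identityʳ b))
Corner⇒split (skip-𝚞 c) with p , s , refl , i≡ , j≡ ← Corner⇒split c =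
  𝚞 ∷ p , s , refl , i≡ , trans j≡ (cong suc (sym (ℕₚ.+-suc _ _)))
Corner⇒split (skip-𝚍 c) with p , s , refl , i≡ , j≡ ← Corner⇒split c =
  𝚍 ∷ p , s , refl , trans i≡ (cong suc (sym (ℕₚ.+-suc _ _))) , j≡

split⇒Corner : ∀ p {s a b} → Corner (p ++ 𝚞 ∷ 𝚍 ∷ s) a b (suc (a + # 𝚍 p)) (suc (b + # 𝚞 p))
split⇒Corner [] {a = a} {b} rewrite ℕₚ.+-identityʳ a | ℕₚ.+-identityʳ b = here
split⇒Corner (𝚞 ∷ p) {a = a} {b} rewrite ℕₚ.+-suc b (# 𝚞 p) = skip-𝚞 (split⇒Corner p)
split⇒Corner (𝚍 ∷ p) {a = a} {b} rewrite ℕₚ.+-suc a (# 𝚍 p) = skip-𝚍 (split⇒Corner p)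

Corner⇒PeakAbove : ∀ {w i j} → Corner w 0 0 i j → PeakAbove w i j
Corner⇒PeakAbove = Corner⇒split

PeakAbove⇒Corner : ∀ {w i j} → PeakAbove w i j → Corner w 0 0 i j
PeakAbove⇒Corner (p , s , refl , refl , refl) = split⇒Corner p

corner> : ∀ {w a b i j} → Corner w a b i j → a < i × b < j
corner> here = ℕₚ.≤-refl , ℕₚ.≤-refl
corner> (skip-𝚞 c) with p , q ← corner> c = p , ℕₚ.<-trans (ℕₚ.n<1+n _) q
corner> (skip-𝚍 c) with p , q ← corner> c = ℕₚ.<-trans (ℕₚ.n<1+n _) p , q

corner-≤#𝚞 : ∀ {w a b i j} → Corner w a b i j → j ≤ b + # 𝚞 w
corner-≤#𝚞 {b = b} (here {w}) = subst (suc b ≤_) (sym (ℕₚ.+-suc b (# 𝚞 w))) (s≤s (ℕₚ.m≤m+n b _))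
corner-≤#𝚞 {𝚞 ∷ w} {b = b} {j = j} (skip-𝚞 c) = subst (j ≤_) (sym (ℕₚ.+-suc b (# 𝚞 w))) (corner-≤#𝚞 c)
corner-≤#𝚞 (skip-𝚍 c) = corner-≤#𝚞 c

corner-functional : ∀ {w a b i j j′} → Corner w a b i j → Corner w a b i j′ → j ≡ j′
corner-functional here here = refl
corner-functional here (skip-𝚞 (skip-𝚍 c)) = contradiction (proj₁ (corner> c)) (ℕₚ.<-irrefl refl)
corner-functional (skip-𝚞 (skip-𝚍 c)) here = contradiction (proj₁ (corner> c)) (ℕₚ.<-irrefl refl)
corner-functional (skip-𝚞 c) (skip-𝚞 c′) = corner-functional c c′
corner-functional (skip-𝚍 c) (skip-𝚍 c′) = corner-functional c c′

corner-increasing : ∀ {w a b i j i′ j′} → Corner w a b i j → Corner w a b i′ j′ → i < i′ → j < j′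
corner-increasing here here lt = contradiction lt (ℕₚ.<-irrefl refl)
corner-increasing here (skip-𝚞 (skip-𝚍 c)) lt = proj₂ (corner> c)
corner-increasing (skip-𝚞 (skip-𝚍 c)) here lt = contradiction (proj₁ (corner> c)) (ℕₚ.<-asym lt)
corner-increasing (skip-𝚞 c) (skip-𝚞 c′) lt = corner-increasing c c′ lt
corner-increasing (skip-𝚍 c) (skip-𝚍 c′) lt = corner-increasing c c′ lt

corner? : ∀ w a b i → Dec (∃ (Corner w a b i))
corner? [] a b i = no λ ()
corner? (𝚍 ∷ w) a b i = Dec.map′ (λ (j , c) → j , skip-𝚍 c) (λ { (j , skip-𝚍 c) → j , c })
  (corner? w (suc a) b i)
corner? (𝚞 ∷ []) a b i = no λ { (_ , skip-𝚞 ()) }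
corner? (𝚞 ∷ 𝚞 ∷ w) a b i = Dec.map′ (λ (j , c) → j , skip-𝚞 c) (λ { (j , skip-𝚞 c) → j , c })
  (corner? (𝚞 ∷ w) a (suc b) i)
corner? (𝚞 ∷ 𝚍 ∷ w) a b i with i ℕₚ.≟ suc a
... | yes refl = yes (_ , here)
... | no i≢ = Dec.map′ (λ (j , c) → j , skip-𝚞 (skip-𝚍 c))
  (λ { (j , skip-𝚞 (skip-𝚍 c)) → j , c ; (_ , here) → contradiction refl i≢ })
  (corner? w (suc a) (suc b) i)

first-corner : ∀ w a b → 0 < # 𝚍 w → ∃ λ j → b < j × Corner (𝚞 ∷ w) a b (suc a) j
first-corner (𝚍 ∷ w) a b _ = suc b , ℕₚ.≤-refl , here
first-corner (𝚞 ∷ w) a b 0<# with j , b<j , c ← first-corner w a (suc b) 0<# =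
  j , ℕₚ.<-trans (ℕₚ.n<1+n b) b<j , skip-𝚞 c

corners-determine : ∀ w w′ a b → # 𝚞 w ≡ # 𝚞 w′ → # 𝚍 w ≡ # 𝚍 w′ →
  (∀ {i j} → Corner w a b i j → Corner w′ a b i j) →
  (∀ {i j} → Corner w′ a b i j → Corner w a b i j) → w ≡ w′
corners-determine [] [] a b _ _ _ _ = refl
corners-determine [] (𝚞 ∷ _) a b () _ _ _
corners-determine [] (𝚍 ∷ _) a b _ () _ _
corners-determine (𝚞 ∷ _) [] a b () _ _ _
corners-determine (𝚍 ∷ _) [] a b _ () _ _
corners-determine (𝚍 ∷ w) (𝚍 ∷ w′) a b eu ed f g =
  cong (𝚍 ∷_) (corners-determine w w′ (suc a) b eu (ℕₚ.suc-injective ed) (strip f) (strip g))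
  where
  strip : ∀ {v v′} → (∀ {i j} → Corner (𝚍 ∷ v) a b i j → Corner (𝚍 ∷ v′) a b i j) →
    ∀ {i j} → Corner v (suc a) b i j → Corner v′ (suc a) b i j
  strip h c with skip-𝚍 c′ ← h (skip-𝚍 c) = c′
corners-determine (𝚞 ∷ w) (𝚞 ∷ w′) a b eu ed f g =
  cong (𝚞 ∷_) (corners-determine w w′ a (suc b) (ℕₚ.suc-injective eu) ed (strip f) (strip g))
  where
  strip : ∀ {v v′} → (∀ {i j} → Corner (𝚞 ∷ v) a b i j → Corner (𝚞 ∷ v′) a b i j) →
    ∀ {i j} → Corner v a (suc b) i j → Corner v′ a (suc b) i j
  strip h c with h (skip-𝚞 c)
  ... | skip-𝚞 c′ = c′
  ... | here = contradiction (proj₂ (corner> c)) (ℕₚ.<-irrefl refl)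
corners-determine (𝚞 ∷ w) (𝚍 ∷ w′) a b eu ed f g
  with _ , _ , c ← first-corner w a b (subst (0 <_) (sym ed) (s≤s z≤n))
  with skip-𝚍 c′ ← f c = contradiction (proj₁ (corner> c′)) (ℕₚ.<-irrefl refl)
corners-determine (𝚍 ∷ w) (𝚞 ∷ w′) a b eu ed f g
  with _ , _ , c ← first-corner w′ a b (subst (0 <_) ed (s≤s z≤n))
  with skip-𝚍 c′ ← g c = contradiction (proj₁ (corner> c′)) (ℕₚ.<-irrefl refl)

-- Every point (# 𝚍 , # 𝚞) visited by a path starting at (a , b) satisfies Q.
Visits : (ℕ → ℕ → Set) → Word → ℕ → ℕ → Set
Visits Q []      a b = Q a b
Visits Q (𝚞 ∷ w) a b = Q a b × Visits Q w a (suc b)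
Visits Q (𝚍 ∷ w) a b = Q a b × Visits Q w (suc a) b

visits-start : ∀ {Q} w {a b} → Visits Q w a b → Q a b
visits-start []      v = v
visits-start (𝚞 ∷ w) v = proj₁ v
visits-start (𝚍 ∷ w) v = proj₁ v

visits-prefix : ∀ {Q} p s {a b} → Visits Q (p ++ s) a b → Q (a + # 𝚍 p) (b + # 𝚞 p)
visits-prefix {Q} [] s {a} {b} v =
  subst₂ Q (sym (ℕₚ.+-identityʳ a)) (sym (ℕₚ.+-identityʳ b)) (visits-start s v)
visits-prefix {Q} (𝚞 ∷ p) s {a} {b} (_ , v) =
  subst (Q _) (sym (ℕₚ.+-suc b (# 𝚞 p))) (visits-prefix p s v)
visits-prefix {Q} (𝚍 ∷ p) s {a} {b} (_ , v) =
  subst (λ x → Q x (b + # 𝚞 p)) (sym (ℕₚ.+-suc a (# 𝚍 p))) (visits-prefix p s v)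

prefix-visits : ∀ {Q} w {a b} →
  (∀ p s → w ≡ p ++ s → Q (a + # 𝚍 p) (b + # 𝚞 p)) → Visits Q w a b
prefix-visits {Q} [] {a} {b} h = origin (h [] [] refl)
  where origin = subst₂ Q (ℕₚ.+-identityʳ a) (ℕₚ.+-identityʳ b)
prefix-visits {Q} (𝚞 ∷ w) {a} {b} h = origin (h [] _ refl) , prefix-visits w λ p s eq →
  subst (Q (a + # 𝚍 p)) (ℕₚ.+-suc b (# 𝚞 p)) (h (𝚞 ∷ p) s (cong (𝚞 ∷_) eq))
  where origin = subst₂ Q (ℕₚ.+-identityʳ a) (ℕₚ.+-identityʳ b)
prefix-visits {Q} (𝚍 ∷ w) {a} {b} h = origin (h [] _ refl) , prefix-visits w λ p s eq →
  subst (λ x → Q x (b + # 𝚞 p)) (ℕₚ.+-suc a (# 𝚍 p)) (h (𝚍 ∷ p) s (cong (𝚍 ∷_) eq))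
  where origin = subst₂ Q (ℕₚ.+-identityʳ a) (ℕₚ.+-identityʳ b)

corner-above : ∀ {w a b i j} → Visits _≤_ w a b → Corner w a b i j → i ≤ j
corner-above v here = s≤s (proj₁ v)
corner-above (_ , v) (skip-𝚞 c) = corner-above v c
corner-above (_ , v) (skip-𝚍 c) = corner-above v c

corner-covers : ∀ w {a b} i → Visits _≤_ w a b → a < i → i ≤ a + # 𝚍 w →
  i ≤ b ⊎ ∃₂ λ i′ j′ → Corner w a b i′ j′ × i′ ≤ i × i ≤ j′
corner-covers [] {a} i v a<i i≤ =
  contradiction (subst (i ≤_) (ℕₚ.+-identityʳ a) i≤) (ℕₚ.<⇒≱ a<i)
corner-covers (𝚍 ∷ w) {a} {b} i (_ , v) a<i i≤ with i ℕₚ.≟ suc a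
... | yes refl = inj₁ (visits-start w v)
... | no i≢ with corner-covers w i v (ℕₚ.≤∧≢⇒< a<i (i≢ ∘ sym)) (subst (i ≤_) (ℕₚ.+-suc a (# 𝚍 w)) i≤)
... | inj₁ i≤b = inj₁ i≤b
... | inj₂ (i′ , j′ , c , p , q) = inj₂ (i′ , j′ , skip-𝚍 c , p , q)
corner-covers (𝚞 ∷ w) {a} {b} i (_ , v) a<i i≤ with corner-covers w i v a<i i≤
... | inj₂ (i′ , j′ , c , p , q) = inj₂ (i′ , j′ , skip-𝚞 c , p , q)
... | inj₁ i≤1+b with j′ , b<j′ , c ← first-corner w a b
        (ℕₚ.+-cancelˡ-< a 0 (# 𝚍 w) (subst (_< a + # 𝚍 w) (sym (ℕₚ.+-identityʳ a)) (ℕₚ.<-≤-trans a<i i≤))) =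
  inj₂ (suc a , j′ , c , a<i , ℕₚ.≤-trans i≤1+b b<j′)

-- The path from (0,0) to (n,n) whose peaks are the cells (i + 1 , R(i) + 1),
-- for R the graph of a strictly increasing partial function.
module Build {n : ℕ} (R : ℕ → ℕ → Set) (R? : ∀ i → Dec (∃ (R i)))
  (R-dom : ∀ {i j} → R i j → i < n) (R-< : ∀ {i j} → R i j → j < n)
  (R-functional : ∀ {i j j′} → R i j → R i j′ → j ≡ j′)
  (R-increasing : ∀ {i j i′ j′} → R i j → R i′ j′ → i < i′ → j < j′)
  where

  rise : ℕ → Word → Word
  rise k w = replicate k 𝚞 ++ w

  build : ℕ → ℕ → ℕ → Word
  build zero    i b = rise (n ∸ b) []
  build (suc k) i b with R? i
  ... | yes (j , _) = rise (suc (j ∸ b)) (𝚍 ∷ build k (suc i) (suc j))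
  ... | no _        = 𝚍 ∷ build k (suc i) b

  Low : ℕ → ℕ → Set
  Low i b = ∀ {i′ j′} → i ≤ i′ → R i′ j′ → b ≤ j′

  low-yes : ∀ {i j} → R i j → Low (suc i) (suc j)
  low-yes r i<i′ r′ = R-increasing r r′ i<i′

  low-no : ∀ {i b} → Low i b → Low (suc i) b
  low-no low i<i′ = low (ℕₚ.<⇒≤ i<i′)

  #𝚍-rise : ∀ k w → # 𝚍 (rise k w) ≡ # 𝚍 w
  #𝚍-rise zero    w = refl
  #𝚍-rise (suc k) w = #𝚍-rise k w

  #𝚞-rise : ∀ k w → # 𝚞 (rise k w) ≡ k + # 𝚞 w
  #𝚞-rise zero    w = refl
  #𝚞-rise (suc k) w = cong suc (#𝚞-rise k w)

  #𝚍-build : ∀ k i b → # 𝚍 (build k i b) ≡ k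
  #𝚍-build zero    i b = #𝚍-rise (n ∸ b) []
  #𝚍-build (suc k) i b with R? i
  ... | yes (j , _) = trans (#𝚍-rise (j ∸ b) _) (cong suc (#𝚍-build k (suc i) (suc j)))
  ... | no _        = cong suc (#𝚍-build k (suc i) b)

  #𝚞-build : ∀ k i b → b ≤ n → Low i b → b + # 𝚞 (build k i b) ≡ n
  #𝚞-build zero    i b b≤n _ = trans (cong (b +_) (trans (#𝚞-rise (n ∸ b) []) (ℕₚ.+-identityʳ _)))
    (ℕₚ.m+[n∸m]≡n b≤n)
  #𝚞-build (suc k) i b b≤n low with R? i
  ... | no _ = #𝚞-build k (suc i) b b≤n (low-no low)
  ... | yes (j , r) = begin
    b + suc (# 𝚞 (rise (j ∸ b) (𝚍 ∷ w)))  ≡⟨ cong (λ x → b + suc x) (#𝚞-rise (j ∸ b) (𝚍 ∷ w)) ⟩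
    b + suc ((j ∸ b) + # 𝚞 w)              ≡⟨ ℕₚ.+-suc b _ ⟩
    suc (b + ((j ∸ b) + # 𝚞 w))            ≡⟨ cong suc (ℕₚ.+-assoc b (j ∸ b) (# 𝚞 w)) ⟨
    suc ((b + (j ∸ b)) + # 𝚞 w)            ≡⟨ cong (λ x → suc (x + # 𝚞 w)) (ℕₚ.m+[n∸m]≡n (low ℕₚ.≤-refl r)) ⟩
    suc j + # 𝚞 w                          ≡⟨ #𝚞-build k (suc i) (suc j) (R-< r) (low-yes r) ⟩
    n ∎
    where
    open ≡.≡-Reasoning
    w = build k (suc i) (suc j)

  corner-rise : ∀ k w a b → Corner (rise (suc k) (𝚍 ∷ w)) a b (suc a) (suc (b + k))
  corner-rise zero    w a b rewrite ℕₚ.+-identityʳ b = here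
  corner-rise (suc k) w a b rewrite ℕₚ.+-suc b k = skip-𝚞 (corner-rise k w a (suc b))

  rise-corner : ∀ k w a b {c r} → Corner w (suc a) (suc (b + k)) c r →
    Corner (rise (suc k) (𝚍 ∷ w)) a b c r
  rise-corner zero    w a b c rewrite ℕₚ.+-identityʳ b = skip-𝚞 (skip-𝚍 c)
  rise-corner (suc k) w a b c rewrite ℕₚ.+-suc b k = skip-𝚞 (rise-corner k w a (suc b) c)

  rise-corner⁻ : ∀ k w a b {c r} → Corner (rise (suc k) (𝚍 ∷ w)) a b c r →
    (c ≡ suc a × r ≡ suc (b + k)) ⊎ Corner w (suc a) (suc (b + k)) c r
  rise-corner⁻ zero w a b c rewrite ℕₚ.+-identityʳ b with c
  ... | here = inj₁ (refl , refl)
  ... | skip-𝚞 (skip-𝚍 c′) = inj₂ c′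
  rise-corner⁻ (suc k) w a b (skip-𝚞 c) rewrite ℕₚ.+-suc b k = rise-corner⁻ k w a (suc b) c

  no-corner : ∀ k {a b c r} → ¬ Corner (rise k []) a b c r
  no-corner zero ()
  no-corner (suc zero) (skip-𝚞 ())
  no-corner (suc (suc k)) (skip-𝚞 c) = no-corner (suc k) c

  corner⇒R : ∀ k i b {c r} → Low i b → Corner (build k i b) i b c r →
    ∃₂ λ i′ j′ → R i′ j′ × c ≡ suc i′ × r ≡ suc j′
  corner⇒R zero i b low c = contradiction c (no-corner (n ∸ b))
  corner⇒R (suc k) i b low c with R? i
  corner⇒R (suc k) i b low (skip-𝚍 c) | no _ = corner⇒R k (suc i) b (low-no low) c
  ... | yes (j , r) with rise-corner⁻ (j ∸ b) (build k (suc i) (suc j)) i b c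
  ... | inj₁ (c≡ , r≡) =
    i , j , r , c≡ , trans r≡ (cong suc (ℕₚ.m+[n∸m]≡n (low ℕₚ.≤-refl r)))
  ... | inj₂ c′ = corner⇒R k (suc i) (suc j) (low-yes r)
    (subst (λ x → Corner (build k (suc i) (suc j)) (suc i) (suc x) _ _) (ℕₚ.m+[n∸m]≡n (low ℕₚ.≤-refl r)) c′)

  R⇒corner : ∀ k i b → k + i ≡ n → Low i b → ∀ {i′ j′} → i ≤ i′ → R i′ j′ →
    Corner (build k i b) i b (suc i′) (suc j′)
  R⇒corner zero i b refl low i≤i′ r = contradiction (R-dom r) (ℕₚ.≤⇒≯ i≤i′)
  R⇒corner (suc k) i b eq low {i′} i≤i′ r′ with R? i
  ... | no ∄j = skip-𝚍 (R⇒corner k (suc i) b (trans (ℕₚ.+-suc k i) eq) (low-no low)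
    (ℕₚ.≤∧≢⇒< i≤i′ (λ { refl → ∄j (_ , r′) })) r′)
  ... | yes (j , r) with i ℕₚ.≟ i′
  ... | yes refl = subst (λ x → Corner _ _ _ _ (suc x))
    (trans (ℕₚ.m+[n∸m]≡n (low ℕₚ.≤-refl r)) (R-functional r r′))
    (corner-rise (j ∸ b) _ i b)
  ... | no i≢i′ = rise-corner (j ∸ b) _ i b
    (subst (λ x → Corner (build k (suc i) (suc j)) (suc i) (suc x) _ _) (sym (ℕₚ.m+[n∸m]≡n (low ℕₚ.≤-refl r)))
      (R⇒corner k (suc i) (suc j) (trans (ℕₚ.+-suc k i) eq) (low-yes r)
        (ℕₚ.≤∧≢⇒< i≤i′ i≢i′) r′))

  path : Word
  path = build n 0 0

  #𝚍-path : # 𝚍 path ≡ n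
  #𝚍-path = #𝚍-build n 0 0

  #𝚞-path : # 𝚞 path ≡ n
  #𝚞-path = #𝚞-build n 0 0 z≤n (λ _ _ → z≤n)

  path-corner⁻ : ∀ {c r} → Corner path 0 0 c r → ∃₂ λ i j → R i j × c ≡ suc i × r ≡ suc j
  path-corner⁻ = corner⇒R n 0 0 (λ _ _ → z≤n)

  path-corner : ∀ {i j} → R i j → Corner path 0 0 (suc i) (suc j)
  path-corner = R⇒corner n 0 0 (ℕₚ.+-identityʳ n) (λ _ _ → z≤n) z≤n

  module _ (Q : ℕ → ℕ → Set) (Q-origin : Q 0 0)
    (Q-rise : ∀ {i b j t} → R i j → Q i b → b ≤ t → t ≤ suc j → Q i t)
    (Q-step : ∀ {i j} → R i j → Q (suc i) (suc j))
    (Q-flat : ∀ {i b} → i < n → ¬ ∃ (R i) → (∀ {i′ j′} → i′ < i → R i′ j′ → j′ < b) →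
              Q i b → Q (suc i) b)
    (Q-end : ∀ {b t} → Q n b → b ≤ t → t ≤ n → Q n t)
    where

    private
      visits-rise : ∀ k w {a b} → (∀ {t} → b ≤ t → t ≤ b + k → Q a t) →
        (Visits Q w a (b + k)) → Visits Q (rise k w) a b
      visits-rise zero w {b = b} h v rewrite ℕₚ.+-identityʳ b = v
      visits-rise (suc k) w {a} {b} h v = h ℕₚ.≤-refl (ℕₚ.m≤m+n b _) , visits-rise k w
        (λ {t} b<t t≤ → h (ℕₚ.<⇒≤ b<t) (subst (t ≤_) (sym (ℕₚ.+-suc b k)) t≤))
        (subst (Visits Q w a) (ℕₚ.+-suc b k) v)

      visits-build : ∀ k i b → k + i ≡ n → b ≤ n → Low i b →
        (∀ {i′ j′} → i′ < i → R i′ j′ → j′ < b) → Q i b → Visits Q (build k i b) i b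
      visits-build zero i b refl b≤n low hgt q = visits-rise (i ∸ b) []
        (λ {t} b≤t t≤ → Q-end q b≤t (subst (t ≤_) (ℕₚ.m+[n∸m]≡n b≤n) t≤))
        (subst (Q i) (sym (ℕₚ.m+[n∸m]≡n b≤n)) (Q-end q b≤n ℕₚ.≤-refl))
      visits-build (suc k) i b eq b≤n low hgt q with R? i
      ... | no ∄j = q , visits-build k (suc i) b eq′ b≤n (low-no low)
        (λ { (s≤s i′≤i) r → hgt (ℕₚ.≤∧≢⇒< i′≤i (λ { refl → ∄j (_ , r) })) r })
        (Q-flat (subst (i <_) eq (s≤s (ℕₚ.m≤n+m i k))) ∄j hgt q)
        where eq′ = trans (ℕₚ.+-suc k i) eq
      ... | yes (j , r) = visits-rise (suc (j ∸ b)) _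
        (λ {t} b≤t t≤ → Q-rise r q b≤t (subst (t ≤_) top t≤))
        (subst (Visits Q (𝚍 ∷ build k (suc i) (suc j)) i) (sym top)
          ( Q-rise r q (ℕₚ.m≤n⇒m≤1+n b≤j) ℕₚ.≤-refl
          , visits-build k (suc i) (suc j) (trans (ℕₚ.+-suc k i) eq) (R-< r) (low-yes r)
              hgt′ (Q-step r)))
        where
        b≤j = low ℕₚ.≤-refl r
        top : b + suc (j ∸ b) ≡ suc j
        top = trans (ℕₚ.+-suc b _) (cong suc (ℕₚ.m+[n∸m]≡n b≤j))
        hgt′ : ∀ {i′ j′} → i′ < suc i → R i′ j′ → j′ < suc j
        hgt′ {i′} (s≤s i′≤i) r′ with i′ ℕₚ.≟ i
        ... | yes refl = s≤s (ℕₚ.≤-reflexive (R-functional r′ r))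
        ... | no i′≢i  = ℕₚ.m≤n⇒m≤1+n (R-increasing r′ r (ℕₚ.≤∧≢⇒< i′≤i i′≢i))

    path-visits : Visits Q path 0 0
    path-visits = visits-build n 0 0 (ℕₚ.+-identityʳ n) z≤n (λ _ _ → z≤n) (λ ()) Q-origin

swap : Letter → Letter
swap 𝚞 = 𝚍
swap 𝚍 = 𝚞

swap-involutive : ∀ w → map swap (map swap w) ≡ w
swap-involutive []      = refl
swap-involutive (𝚞 ∷ w) = cong (𝚞 ∷_) (swap-involutive w)
swap-involutive (𝚍 ∷ w) = cong (𝚍 ∷_) (swap-involutive w)

#𝚞-swap : ∀ w → # 𝚞 (map swap w) ≡ # 𝚍 w
#𝚞-swap []      = refl
#𝚞-swap (𝚞 ∷ w) = #𝚞-swap w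
#𝚞-swap (𝚍 ∷ w) = cong suc (#𝚞-swap w)

#𝚍-swap : ∀ w → # 𝚍 (map swap w) ≡ # 𝚞 w
#𝚍-swap []      = refl
#𝚍-swap (𝚞 ∷ w) = cong suc (#𝚍-swap w)
#𝚍-swap (𝚍 ∷ w) = #𝚍-swap w

PeakAbove⇒ValleyBelow : ∀ {w i j} → PeakAbove w i j → ValleyBelow (map swap w) i j
PeakAbove⇒ValleyBelow (p , s , refl , refl , refl) =
  map swap p , map swap s , Listₚ.map-++ swap p _ , cong suc (sym (#𝚞-swap p)) , cong suc (sym (#𝚍-swap p))

ValleyBelow⇒PeakAbove : ∀ {w i j} → ValleyBelow w i j → PeakAbove (map swap w) i j
ValleyBelow⇒PeakAbove (p , s , refl , refl , refl) =
  map swap p , map swap s , Listₚ.map-++ swap p _ , cong suc (sym (#𝚍-swap p)) , cong suc (sym (#𝚞-swap p))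

peaks-determine : ∀ {n} (D E : Dyck n) →
  (∀ {i j} → PeakAbove (word D) i j → PeakAbove (word E) i j) →
  (∀ {i j} → PeakAbove (word E) i j → PeakAbove (word D) i j) → word D ≡ word E
peaks-determine D E f g = corners-determine (word D) (word E) 0 0
  (trans (#𝚞 D) (sym (#𝚞 E))) (trans (#𝚍 D) (sym (#𝚍 E)))
  (PeakAbove⇒Corner ∘ f ∘ Corner⇒PeakAbove) (PeakAbove⇒Corner ∘ g ∘ Corner⇒PeakAbove)

valleys-determine : ∀ {n} (D E : Dyck n) →
  (∀ {i j} → ValleyBelow (word D) i j → ValleyBelow (word E) i j) →
  (∀ {i j} → ValleyBelow (word E) i j → ValleyBelow (word D) i j) → word D ≡ word E
valleys-determine D E f g = trans (sym (swap-involutive (word D))) (trans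
  (cong (map swap) (corners-determine (map swap (word D)) (map swap (word E)) 0 0
    (trans (#𝚞-swap (word D)) (trans (#𝚍 D) (sym (trans (#𝚞-swap (word E)) (#𝚍 E)))))
    (trans (#𝚍-swap (word D)) (trans (#𝚞 D) (sym (trans (#𝚍-swap (word E)) (#𝚞 E)))))
    (transfer D E f) (transfer E D g)))
  (swap-involutive (word E)))
  where
  transfer : ∀ (D E : Dyck _) → (∀ {i j} → ValleyBelow (word D) i j → ValleyBelow (word E) i j) →
    ∀ {i j} → Corner (map swap (word D)) 0 0 i j → Corner (map swap (word E)) 0 0 i j
  transfer D E h c = PeakAbove⇒Corner (ValleyBelow⇒PeakAbove (h
    (subst (λ w → ValleyBelow w _ _) (swap-involutive (word D))
      (PeakAbove⇒ValleyBelow (Corner⇒PeakAbove c)))))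

module _ {n} (π : S321 n) where

  graph? : ∀ {P : Fin n → Set} → Decidable P → ∀ i →
    Dec (∃ λ j → ∃ λ k → i ≡ toℕ k × j ≡ toℕ (π ⟨$⟩ k) × P k)
  graph? P? i = Dec.map′ (λ (k , e , p) → toℕ (π ⟨$⟩ k) , k , e , refl , p)
    (λ (_ , k , e , _ , p) → k , e , p) (Finₚ.any? λ k → (i ℕₚ.≟ toℕ k) ×-dec P? k)

  module WeakExc where
    R : ℕ → ℕ → Set
    R i j = ∃ λ k → i ≡ toℕ k × j ≡ toℕ (π ⟨$⟩ k) × k Fin.≤ π ⟨$⟩ k

    R? : ∀ i → Dec (∃ (R i))
    R? = graph? (λ k → k Finₚ.≤? π ⟨$⟩ k)

    R-dom : ∀ {i j} → R i j → i < n
    R-dom (k , refl , _) = Finₚ.toℕ<n k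

    R-< : ∀ {i j} → R i j → j < n
    R-< (k , _ , refl , _) = Finₚ.toℕ<n (π ⟨$⟩ k)

    R-functional : ∀ {i j j′} → R i j → R i j′ → j ≡ j′
    R-functional (k , e , refl , _) (k′ , e′ , refl , _) =
      cong (λ x → toℕ (π ⟨$⟩ x)) (Finₚ.toℕ-injective (trans (sym e) e′))

    R-increasing : ∀ {i j i′ j′} → R i j → R i′ j′ → i < i′ → j < j′
    R-increasing (k , refl , refl , _) (k′ , refl , refl , p) k<k′ =
      weakExc-increasing (perm π) (avoids π) k<k′ p

    open Build R R? R-dom R-< R-functional R-increasing public

    flat : ∀ {i b} → i < n → ¬ ∃ (R i) → (∀ {i′ j′} → i′ < i → R i′ j′ → j′ < b) → i < b
    flat {i} {b} i<n ¬r hgt = subst (_< b) (sym i≡) (ℕₚ.≤-<-trans k≤πz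
      (hgt (subst (toℕ z <_) (sym i≡) z<k) (z , refl , refl , ℕₚ.<⇒≤ (ℕₚ.<-≤-trans z<k k≤πz))))
      where
      k   = fromℕ< i<n
      i≡  = sym (Finₚ.toℕ-fromℕ< i<n)
      arc = covered π {k} (ℕₚ.≰⇒> λ le → ¬r (_ , k , i≡ , refl , le))
      z    = proj₁ arc
      z<k  = proj₁ (proj₂ arc)
      k≤πz = proj₂ (proj₂ arc)

    visits : Visits _≤_ path 0 0
    visits = path-visits _≤_ z≤n
      (λ _ i≤b b≤t _ → ℕₚ.≤-trans i≤b b≤t)
      (λ { (k , refl , refl , p) → s≤s p })
      (λ i<n ¬r hgt _ → flat i<n ¬r hgt)
      (λ n≤b b≤t _ → ℕₚ.≤-trans n≤b b≤t)

    dyck : Dyck n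
    dyck = record
      { word   = path
      ; #𝚞     = #𝚞-path
      ; #𝚍     = #𝚍-path
      ; prefix = λ p s eq → visits-prefix p s (subst (λ w → Visits _≤_ w 0 0) eq visits)
      }

    spec : PeaksAtWeakExcedances π dyck
    spec i j = mk⇔
      (λ peak → let _ , _ , (k , e , e′ , p) , i≡ , j≡ = path-corner⁻ (PeakAbove⇒Corner peak) in
        k , trans i≡ (cong suc e) , trans j≡ (cong suc e′) , s≤s p)
      (λ { (k , refl , refl , s≤s p) → Corner⇒PeakAbove (path-corner (k , refl , refl , p)) })

  module AntiExc where
    R : ℕ → ℕ → Set
    R i j = ∃ λ k → i ≡ toℕ k × j ≡ toℕ (π ⟨$⟩ k) × π ⟨$⟩ k Fin.< k

    R? : ∀ i → Dec (∃ (R i))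
    R? = graph? (λ k → π ⟨$⟩ k Finₚ.<? k)

    R-dom : ∀ {i j} → R i j → i < n
    R-dom (k , refl , _) = Finₚ.toℕ<n k

    R-< : ∀ {i j} → R i j → j < n
    R-< (k , _ , refl , _) = Finₚ.toℕ<n (π ⟨$⟩ k)

    R-functional : ∀ {i j j′} → R i j → R i j′ → j ≡ j′
    R-functional (k , e , refl , _) (k′ , e′ , refl , _) =
      cong (λ x → toℕ (π ⟨$⟩ x)) (Finₚ.toℕ-injective (trans (sym e) e′))

    R-increasing : ∀ {i j i′ j′} → R i j → R i′ j′ → i < i′ → j < j′
    R-increasing (k , refl , refl , p) (k′ , refl , refl , _) k<k′ =
      nonExc-increasing (perm π) (avoids π) k<k′ (ℕₚ.<⇒≤ p)

    open Build R R? R-dom R-< R-functional R-increasing public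

    visits : Visits (λ a b → b ≤ a) path 0 0
    visits = path-visits (λ a b → b ≤ a) z≤n
      (λ { (k , refl , refl , p) _ _ t≤ → ℕₚ.≤-trans t≤ p })
      (λ { (k , refl , refl , p) → ℕₚ.m≤n⇒m≤1+n p })
      (λ _ _ _ b≤i → ℕₚ.m≤n⇒m≤1+n b≤i)
      (λ _ _ t≤n → t≤n)

    dyck : Dyck n
    dyck = record
      { word   = map swap path
      ; #𝚞     = trans (#𝚞-swap path) #𝚍-path
      ; #𝚍     = trans (#𝚍-swap path) #𝚞-path
      ; prefix = λ p s eq → subst₂ _≤_ (#𝚞-swap p) (#𝚍-swap p)
          (visits-prefix (map swap p) (map swap s) (subst (λ w → Visits (λ a b → b ≤ a) w 0 0)
            (trans (sym (swap-involutive path)) (trans (cong (map swap) eq) (Listₚ.map-++ swap p s)))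
            visits))
      }

    spec : ValleysAtAntiExcedances π dyck
    spec i j = mk⇔
      (λ valley → let _ , _ , (k , e , e′ , p) , i≡ , j≡ = path-corner⁻ (PeakAbove⇒Corner
                        (subst (λ w → PeakAbove w i j) (swap-involutive path)
                          (ValleyBelow⇒PeakAbove valley))) in
        k , trans i≡ (cong suc e) , trans j≡ (cong suc e′) , s≤s p)
      (λ { (k , refl , refl , s≤s p) →
        PeakAbove⇒ValleyBelow (Corner⇒PeakAbove (path-corner (k , refl , refl , p))) })

E-p : ∀ {n} → S321 n → Dyck n
E-p = WeakExc.dyck

E-p-peaks : ∀ {n} (π : S321 n) → PeaksAtWeakExcedances π (E-p π)
E-p-peaks = WeakExc.spec

E-p-unique : ∀ {n} (π : S321 n) (D : Dyck n) → PeaksAtWeakExcedances π D → word D ≡ word (E-p π)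
E-p-unique π D spec = peaks-determine D (E-p π)
  (λ {i} {j} → Equivalence.from (E-p-peaks π i j) ∘ Equivalence.to (spec i j))
  (λ {i} {j} → Equivalence.from (spec i j) ∘ Equivalence.to (E-p-peaks π i j))

D-v : ∀ {n} → S321 n → Dyck n
D-v = AntiExc.dyck

D-v-valleys : ∀ {n} (π : S321 n) → ValleysAtAntiExcedances π (D-v π)
D-v-valleys = AntiExc.spec

D-v-unique : ∀ {n} (π : S321 n) (D : Dyck n) → ValleysAtAntiExcedances π D → word D ≡ word (D-v π)
D-v-unique π D spec = valleys-determine D (D-v π)
  (λ {i} {j} → Equivalence.from (D-v-valleys π i j) ∘ Equivalence.to (spec i j))
  (λ {i} {j} → Equivalence.from (spec i j) ∘ Equivalence.to (D-v-valleys π i j))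

E-p-cong : ∀ {n} {π σ : S321 n} → (∀ i → π ⟨$⟩ i ≡ σ ⟨$⟩ i) → word (E-p π) ≡ word (E-p σ)
E-p-cong {n} {π} {σ} eq = E-p-unique σ (E-p π) λ i j → mk⇔
  (λ peak → move π σ eq (Equivalence.to (E-p-peaks π i j) peak))
  (λ exc → Equivalence.from (E-p-peaks π i j) (move σ π (sym ∘ eq) exc))
  where
  move : ∀ (α β : S321 n) → (∀ i → α ⟨$⟩ i ≡ β ⟨$⟩ i) → ∀ {i j} →
    (∃ λ k → i ≡ ⟦ k ⟧ × j ≡ ⟦ α ⟨$⟩ k ⟧ × ⟦ k ⟧ ≤ ⟦ α ⟨$⟩ k ⟧) →
    (∃ λ k → i ≡ ⟦ k ⟧ × j ≡ ⟦ β ⟨$⟩ k ⟧ × ⟦ k ⟧ ≤ ⟦ β ⟨$⟩ k ⟧)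
  move α β eq (k , e , e′ , p) =
    k , e , trans e′ (cong ⟦_⟧ (eq k)) , subst (λ x → ⟦ k ⟧ ≤ ⟦ x ⟧) (eq k) p

E-p-injective : ∀ {n} (π σ : S321 n) → word (E-p π) ≡ word (E-p σ) → ∀ i → π ⟨$⟩ i ≡ σ ⟨$⟩ i
E-p-injective {n} π σ eq = exc-determine π σ (half π σ eq) (half σ π (sym eq))
  where
  half : ∀ (α β : S321 n) → word (E-p α) ≡ word (E-p β) →
    ∀ i → i Fin.< α ⟨$⟩ i → β ⟨$⟩ i ≡ α ⟨$⟩ i
  half α β eq i i<αi with Equivalence.to (E-p-peaks β ⟦ i ⟧ ⟦ α ⟨$⟩ i ⟧)
    (subst (λ w → PeakAbove w ⟦ i ⟧ ⟦ α ⟨$⟩ i ⟧) eq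
      (Equivalence.from (E-p-peaks α _ _) (i , refl , refl , s≤s (ℕₚ.<⇒≤ i<αi))))
  ... | k , i≡k , αi≡ , _ with refl ← Finₚ.toℕ-injective (ℕₚ.suc-injective i≡k) =
        Finₚ.toℕ-injective (ℕₚ.suc-injective (sym αi≡))

module E-p⁻ {n} (D : Dyck n) where
  R : ℕ → ℕ → Set
  R i j = Corner (word D) 0 0 (suc i) (suc j)

  R? : ∀ i → Dec (∃ (R i))
  R? i = Dec.map′ shift (λ (j , c) → suc j , c) (corner? (word D) 0 0 (suc i))
    where
    shift : ∃ (Corner (word D) 0 0 (suc i)) → ∃ (R i)
    shift (zero  , c) = contradiction (proj₂ (corner> c)) λ ()
    shift (suc j , c) = j , c

  visits : Visits _≤_ (word D) 0 0
  visits = prefix-visits (word D) (prefix D)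

  R-≤ : ∀ {i j} → R i j → i ≤ j
  R-≤ c = ℕ.s≤s⁻¹ (corner-above visits c)

  R-< : ∀ {i j} → R i j → j < n
  R-< {j = j} c = subst (suc j ≤_) (#𝚞 D) (corner-≤#𝚞 c)

  R-functional : ∀ {i j j′} → R i j → R i j′ → j ≡ j′
  R-functional c c′ = ℕₚ.suc-injective (corner-functional c c′)

  R-increasing : ∀ {i j i′ j′} → R i j → R i′ j′ → i < i′ → j < j′
  R-increasing c c′ lt = ℕ.s≤s⁻¹ (corner-increasing c c′ (s≤s lt))

  open Fill R R? R-≤ R-< R-functional R-increasing public

  arc : ∀ k → ¬ ∃ (R (toℕ k)) → filling ⟨$⟩ k Fin.< k
  arc k ¬r with corner-covers (word D) (suc (toℕ k)) visits (s≤s z≤n)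
    (subst (suc (toℕ k) ≤_) (sym (#𝚍 D)) (Finₚ.toℕ<n k))
  ... | inj₁ ()
  ... | inj₂ (zero , _ , c , _) = contradiction (proj₁ (corner> c)) λ ()
  ... | inj₂ (suc i , suc j , c , s≤s i≤k , s≤s k≤j) = filling-strict ¬r c
          (ℕₚ.≤∧≢⇒< i≤k (λ { refl → ¬r (j , c) })) k≤j

  filling-spec : PeaksAtWeakExcedances filling D
  filling-spec i j = mk⇔ (to ∘ PeakAbove⇒Corner) (Corner⇒PeakAbove ∘ from)
    where
    to : ∀ {i j} → Corner (word D) 0 0 i j →
      ∃ λ k → i ≡ ⟦ k ⟧ × j ≡ ⟦ filling ⟨$⟩ k ⟧ × ⟦ k ⟧ ≤ ⟦ filling ⟨$⟩ k ⟧
    to {zero}          c = contradiction (proj₁ (corner> c)) λ ()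
    to {suc i} {zero}  c = contradiction (proj₂ (corner> c)) λ ()
    to {suc i} {suc j} c =
      k , cong suc (sym k≡) , cong suc (sym πk≡) , subst₂ (λ x y → suc x ≤ suc y) (sym k≡) (sym πk≡) i≤j
      where
      i≤j = corner-above visits c
      i<n : i < n
      i<n = ℕₚ.<-≤-trans i≤j (subst (suc j ≤_) (#𝚞 D) (corner-≤#𝚞 c))
      k   = fromℕ< i<n
      k≡  = Finₚ.toℕ-fromℕ< i<n
      πk≡ = filling-hit {k} (subst (λ x → R x j) (sym k≡) c)
    from : ∀ {i j} → (∃ λ k → i ≡ ⟦ k ⟧ × j ≡ ⟦ filling ⟨$⟩ k ⟧ × ⟦ k ⟧ ≤ ⟦ filling ⟨$⟩ k ⟧) →
      Corner (word D) 0 0 i j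
    from (k , refl , refl , s≤s k≤) with R? (toℕ k)
    ... | yes (j , r) = subst (R (toℕ k)) (sym (filling-hit r)) r
    ... | no ¬r       = contradiction k≤ (ℕₚ.<⇒≱ (arc k ¬r))

E-p-bijection : ∀ n → Inverse (S321-setoid n) (Dyck-setoid n)
E-p-bijection n = inverseOf (S321-setoid n) (Dyck-setoid n)
  E-p (λ {π σ} → E-p-cong {π = π} {σ}) E-p-injective
  E-p⁻.filling (λ D → sym (E-p-unique (E-p⁻.filling D) D (E-p⁻.filling-spec D)))

E-p⁻¹ : ∀ {n} → Dyck n → S321 n
E-p⁻¹ = Inverse.from (E-p-bijection _)

LK : ∀ {n} → Dyck n → Dyck n
LK = D-v ∘ E-p⁻¹

LK𝓢 : ∀ {n} → S321 n → S321 n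
LK𝓢 = E-p⁻¹ ∘ LK ∘ E-p

{-# OPTIONS --safe #-}

-- For 321-avoiding α, inv α is the sum of α(i) − i over the weak excedances i, which are the jumps
-- t(i−1) < t(i) of the running maximum t(i) = max(α(1),…,α(i)), with α(i) = t(i).  Say that β follows
-- α if its excedances are the cells (i , t(i) + 1) for the jumps t(i) < t(i+1) with i ≥ 1.
-- A jump t(i) < t(i+1) contributes t(i+1) − (i+1) to inv α and, if i ≥ 1, t(i) + 1 − i to inv β;
-- these add up to t(i+1) − t(i) modulo 2, so inv α + inv β + 1 telescopes to t(n) = n modulo 2.
-- Now ρ𝓢 π follows π: an interval [i , j] lies in the ideal generated by Exc π iff j < t(i).
-- And π⁻¹ follows LK𝓢 π: the path E-p (LK𝓢 π) = D-v π takes its i-th step 𝚍 at height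
-- t(i), for t the running maximum of LK𝓢 π, so its valleys are at the cells (t(i) + 1 , i).
module Submission where

open import Defs
open import Data.Nat using (ℕ; _≥_)
open import Data.Nat.Divisibility using (_∣_; _∤_; divides; ∣m∣n⇒∣m+n)
open import Data.Integer using (-_)
open import Data.Product using (_×_)
open import Relation.Binary.PropositionalEquality using (_≡_)

open import Data.Bool.Base using (if_then_else_)
open import Data.Fin.Base as Fin using (Fin; toℕ; fromℕ<)
open import Data.Fin.Permutation as Perm using (Permutation′; _⟨$⟩ʳ_)
import Data.Fin.Properties as Finₚ
open import Data.Integer.Base as ℤ using (ℤ; -1ℤ)
import Data.Integer.Properties as ℤₚ
open import Data.List.Base
  using ([]; _∷_; _++_; length; filter; cartesianProduct; tabulate; replicate; map)
import Data.List.Properties as Listₚ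
open import Data.Nat as ℕ using (zero; suc; _+_; _*_; _∸_; _⊔_; _≤_; _<_; z≤n; s≤s)
import Data.Nat.Properties as ℕₚ
open import Data.Nat.Tactic.RingSolver using (solve-∀)
open import Data.Product using (∃; _,_; proj₁; proj₂)
open import Data.Sum.Base using (inj₁; inj₂)
open import Function.Base using (_∘_; id)
open import Function.Bundles using (Inverse; Equivalence)
open import Relation.Binary.PropositionalEquality
  using (_≢_; refl; sym; trans; cong; cong₂; subst; subst₂; module ≡-Reasoning)
open import Relation.Nullary.Decidable using (Dec; yes; no; does; _×-dec_)
open import Relation.Nullary.Negation using (¬_; contradiction)
open import Relation.Unary using (Decidable)

open import Algebra.Properties.CommutativeMonoid.Sum ℕₚ.+-0-commutativeMonoid
  using (sum; sum-cong-≗; sum-replicate-zero; ∑-comm; ∑-distrib-+; sum-permute)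

-- Weighted indicators and counting by sums.

infix 5 _when_

-- The Iverson bracket of `P`, weighted by `x`.
_when_ : ∀ {P : Set} → ℕ → Dec P → ℕ
x when p? = if does p? then x else 0

when-yes : ∀ {P : Set} (p? : Dec P) x → P → x when p? ≡ x
when-yes (yes _) x p = refl
when-yes (no ¬p) x p = contradiction p ¬p

when-no : ∀ {P : Set} (p? : Dec P) x → ¬ P → x when p? ≡ 0
when-no (yes p) x ¬p = contradiction p ¬p
when-no (no _)  x ¬p = refl

when-cong : ∀ {P Q : Set} (p? : Dec P) (q? : Dec Q) x → (P → Q) → (Q → P) → x when p? ≡ x when q?
when-cong (yes p) q? x f g = sym (when-yes q? x (f p))
when-cong (no ¬p) q? x f g = sym (when-no q? x (¬p ∘ g))

length-filter-tabulate : ∀ {A : Set} {P : A → Set} (P? : Decidable P) {n} (f : Fin n → A) →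
  length (filter P? (tabulate f)) ≡ sum λ i → 1 when P? (f i)
length-filter-tabulate P? {zero}  f = refl
length-filter-tabulate P? {suc n} f with P? (f Fin.zero)
... | yes _ = cong suc (length-filter-tabulate P? (f ∘ Fin.suc))
... | no _  = length-filter-tabulate P? (f ∘ Fin.suc)

length-filter-product : ∀ {A B : Set} {P : A × B → Set} (P? : Decidable P) {m n}
  (f : Fin m → A) (g : Fin n → B) →
  length (filter P? (cartesianProduct (tabulate f) (tabulate g)))
    ≡ sum λ i → sum λ j → 1 when P? (f i , g j)
length-filter-product P? {zero}  f g = refl
length-filter-product P? {suc m} f g = begin
  length (filter P? (row ++ rest))                  ≡⟨ cong length (Listₚ.filter-++ P? row rest) ⟩
  length (filter P? row ++ filter P? rest)          ≡⟨ Listₚ.length-++ (filter P? row) ⟩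
  length (filter P? row) + length (filter P? rest)  ≡⟨ cong₂ _+_
    (trans (cong (length ∘ filter P?) (Listₚ.map-tabulate g (f Fin.zero ,_)))
           (length-filter-tabulate P? (λ j → f Fin.zero , g j)))
    (length-filter-product P? (f ∘ Fin.suc) g) ⟩
  sum (λ i → sum λ j → 1 when P? (f i , g j))       ∎
  where
  open ≡-Reasoning
  row  = map (f Fin.zero ,_) (tabulate g)
  rest = cartesianProduct (tabulate (f ∘ Fin.suc)) (tabulate g)

-- Inversions of a permutation and of its inverse.

inversion? : ∀ {n} (π : Permutation′ n) i i′ → Dec (i Fin.< i′ × π ⟨$⟩ʳ i′ Fin.< π ⟨$⟩ʳ i)
inversion? π i i′ = (i Finₚ.<? i′) ×-dec (π ⟨$⟩ʳ i′ Finₚ.<? π ⟨$⟩ʳ i)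

inv-sum : ∀ {n} (π : Permutation′ n) → inv π ≡ sum λ i → sum λ i′ → 1 when inversion? π i i′
inv-sum {n} π = length-filter-product (λ (i , i′) → inversion? π i i′) id id

-- The pair (i , i′) is an inversion of π iff (π(i′) , π(i)) is one of π⁻¹, so reindexing both sums
-- by π and exchanging them turns one count into the other.
inv-flip : ∀ {n} (π : Permutation′ n) → inv (Perm.flip π) ≡ inv π
inv-flip {n} π = begin
  inv (Perm.flip π)                                                 ≡⟨ inv-sum (Perm.flip π) ⟩
  (sum λ j → sum λ j′ → 1 when inversion? (Perm.flip π) j j′)       ≡⟨ sum-permute _ π ⟩
  (sum λ i → sum λ j′ → 1 when inversion? (Perm.flip π) (π ⟨$⟩ʳ i) j′)
    ≡⟨ sum-cong-≗ {n} (λ i →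
         sum-permute (λ j′ → 1 when inversion? (Perm.flip π) (π ⟨$⟩ʳ i) j′) π) ⟩
  (sum λ i → sum λ i′ → 1 when inversion? (Perm.flip π) (π ⟨$⟩ʳ i) (π ⟨$⟩ʳ i′))
    ≡⟨ sum-cong-≗ {n} (λ i → sum-cong-≗ {n} λ i′ → when-cong
         (inversion? (Perm.flip π) (π ⟨$⟩ʳ i) (π ⟨$⟩ʳ i′)) (inversion? π i′ i) 1
         (λ (p , q) → subst₂ Fin._<_ (Perm.inverseˡ π) (Perm.inverseˡ π) q , p)
         (λ (p , q) → q , subst₂ Fin._<_ (sym (Perm.inverseˡ π)) (sym (Perm.inverseˡ π)) p)) ⟩
  (sum λ i → sum λ i′ → 1 when inversion? π i′ i)                   ≡⟨ ∑-comm {n} {n} _ ⟩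
  (sum λ i → sum λ i′ → 1 when inversion? π i i′)                   ≡⟨ inv-sum π ⟨
  inv π                                                             ∎
  where open ≡-Reasoning

-- Inversion number of a 321-avoiding permutation as an excedance sum.

count-below : ∀ {n v} → v ≤ n → sum {n} (λ x → 1 when (toℕ x ℕₚ.<? v)) ≡ v
count-below {n} z≤n = trans
  (sum-cong-≗ {n} (λ x → when-no (toℕ x ℕₚ.<? 0) 1 λ ())) (sum-replicate-zero n)
count-below {suc n} {suc v} (s≤s v≤n) = cong₂ _+_
  (when-yes (0 ℕₚ.<? suc v) 1 (s≤s z≤n))
  (trans (sum-cong-≗ {n} λ x → when-cong (suc (toℕ x) ℕₚ.<? suc v) (toℕ x ℕₚ.<? v) 1
           (λ { (s≤s p) → p }) s≤s)
         (count-below v≤n))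

-- An excedance i is a left-to-right maximum, so i of the π(i) smaller values (counting from 0)
-- lie to its left and the others form inversions with it; a non-excedance tops no inversion.
inversions-at : ∀ {n} (π : S321 n) i →
  sum (λ i′ → 1 when inversion? (perm π) i i′) ≡ toℕ (π ⟨$⟩ i) ∸ toℕ i
inversions-at {n} π i with π ⟨$⟩ i Finₚ.≤? i
... | yes πi≤i = begin
  sum (λ i′ → 1 when inversion? (perm π) i i′)
    ≡⟨ sum-cong-≗ {n} (λ i′ → when-no (inversion? (perm π) i i′) 1
         (λ (i<i′ , p) → ℕₚ.<-asym p (nonExc-increasing (perm π) (avoids π) i<i′ πi≤i))) ⟩
  sum {n} (λ _ → 0)          ≡⟨ sum-replicate-zero n ⟩
  0                          ≡⟨ ℕₚ.m≤n⇒m∸n≡0 πi≤i ⟨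
  toℕ (π ⟨$⟩ i) ∸ toℕ i      ∎
  where open ≡-Reasoning
... | no πi≰i = begin
  sum after                                ≡⟨ ℕₚ.m+n∸n≡m (sum after) (toℕ i) ⟨
  sum after + toℕ i ∸ toℕ i
    ≡⟨ cong (λ x → sum after + x ∸ toℕ i) (count-below (ℕₚ.<⇒≤ (Finₚ.toℕ<n i))) ⟨
  sum after + sum before ∸ toℕ i           ≡⟨ cong (_∸ toℕ i) (∑-distrib-+ after before) ⟨
  sum (λ x → after x + before x) ∸ toℕ i   ≡⟨ cong (_∸ toℕ i) (sum-cong-≗ split) ⟩
  sum (λ x → 1 when (toℕ (π ⟨$⟩ x) ℕₚ.<? toℕ (π ⟨$⟩ i))) ∸ toℕ i
    ≡⟨ cong (_∸ toℕ i) (sum-permute (λ y → 1 when (toℕ y ℕₚ.<? toℕ (π ⟨$⟩ i))) (perm π)) ⟨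
  sum {n} (λ y → 1 when (toℕ y ℕₚ.<? toℕ (π ⟨$⟩ i))) ∸ toℕ i
    ≡⟨ cong (_∸ toℕ i) (count-below (ℕₚ.<⇒≤ (Finₚ.toℕ<n (π ⟨$⟩ i)))) ⟩
  toℕ (π ⟨$⟩ i) ∸ toℕ i                    ∎
  where
  open ≡-Reasoning
  after before : Fin n → ℕ
  after x  = 1 when inversion? (perm π) i x
  before x = 1 when (toℕ x ℕₚ.<? toℕ i)

  split : ∀ x → after x + before x ≡ 1 when (toℕ (π ⟨$⟩ x) ℕₚ.<? toℕ (π ⟨$⟩ i))
  split x with ℕₚ.<-≤-connex (toℕ x) (toℕ i)
  ... | inj₁ x<i = trans
    (cong₂ _+_ (when-no (inversion? (perm π) i x) 1 λ (i<x , _) → ℕₚ.<-asym i<x x<i)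
               (when-yes (toℕ x ℕₚ.<? toℕ i) 1 x<i))
    (sym (when-yes (toℕ (π ⟨$⟩ x) ℕₚ.<? toℕ (π ⟨$⟩ i)) 1
      (weakExc-increasing (perm π) (avoids π) x<i (ℕₚ.<⇒≤ (ℕₚ.≰⇒> πi≰i)))))
  ... | inj₂ i≤x = trans
    (trans (cong (after x +_) (when-no (toℕ x ℕₚ.<? toℕ i) 1 (ℕₚ.≤⇒≯ i≤x))) (ℕₚ.+-identityʳ _))
    (when-cong (inversion? (perm π) i x) (toℕ (π ⟨$⟩ x) ℕₚ.<? toℕ (π ⟨$⟩ i)) 1 proj₂
      (λ p → ℕₚ.≤∧≢⇒< i≤x
        (λ i≡x → ℕₚ.<⇒≢ p (cong (λ y → toℕ (π ⟨$⟩ y)) (sym (Finₚ.toℕ-injective i≡x)))) , p))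

inv-excedances : ∀ {n} (π : S321 n) → inv (perm π) ≡ sum λ i → toℕ (π ⟨$⟩ i) ∸ toℕ i
inv-excedances π = trans (inv-sum (perm π)) (sum-cong-≗ (inversions-at π))

-- Needed because `E-p⁻¹` inverts `E-p` only up to the pointwise equality of `S321-setoid`.
inv-cong : ∀ {n} (π σ : S321 n) → (∀ i → π ⟨$⟩ i ≡ σ ⟨$⟩ i) → inv (perm π) ≡ inv (perm σ)
inv-cong π σ eq = trans (inv-excedances π) (trans
  (sum-cong-≗ λ i → cong (λ x → toℕ x ∸ toℕ i) (eq i)) (sym (inv-excedances σ)))

-- The running maximum and its jumps.

module RunningMax {n} (π : S321 n) where

  -- Positions are counted from 0 here and values from 1. The default 0 outside the range keeps
  -- `max` constant from n on.
  value : ℕ → ℕ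
  value i with i ℕₚ.<? n
  ... | yes i<n = ⟦ π ⟨$⟩ fromℕ< i<n ⟧
  ... | no _    = 0

  value-toℕ : ∀ k → value (toℕ k) ≡ ⟦ π ⟨$⟩ k ⟧
  value-toℕ k with toℕ k ℕₚ.<? n
  ... | yes k<n = cong (λ x → ⟦ π ⟨$⟩ x ⟧) (Finₚ.fromℕ<-toℕ k k<n)
  ... | no k≮n  = contradiction (Finₚ.toℕ<n k) k≮n

  value-outside : ∀ {i} → n ≤ i → value i ≡ 0
  value-outside {i} n≤i with i ℕₚ.<? n
  ... | yes i<n = contradiction i<n (ℕₚ.≤⇒≯ n≤i)
  ... | no _    = refl

  value-≤ : ∀ i → value i ≤ n
  value-≤ i with i ℕₚ.<? n
  ... | yes i<n = Finₚ.toℕ<n (π ⟨$⟩ fromℕ< i<n)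
  ... | no _    = z≤n

  -- max i is the largest of π(1), …, π(i), with positions and values counted from 1.
  max : ℕ → ℕ
  max zero    = 0
  max (suc i) = max i ⊔ value i

  max-step : ∀ i → max i ≤ max (suc i)
  max-step i = ℕₚ.m≤m⊔n (max i) (value i)

  max-mono : ∀ {i j} → i ≤ j → max i ≤ max j
  max-mono {i} i≤j = go (ℕₚ.≤⇒≤′ i≤j)
    where
    go : ∀ {j} → i ℕ.≤′ j → max i ≤ max j
    go ℕ.≤′-refl     = ℕₚ.≤-refl
    go (ℕ.≤′-step p) = ℕₚ.≤-trans (go p) (max-step _)

  max-≤ : ∀ i → max i ≤ n
  max-≤ zero    = z≤n
  max-≤ (suc i) = ℕₚ.⊔-lub (max-≤ i) (value-≤ i)

  max-bounds : ∀ {i} k → toℕ k < i → toℕ (π ⟨$⟩ k) < max i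
  max-bounds {i} k k<i = ℕₚ.≤-trans
    (subst (_≤ max (suc (toℕ k))) (value-toℕ k) (ℕₚ.m≤n⊔m (max (toℕ k)) (value (toℕ k))))
    (max-mono k<i)

  value-attained : ∀ i {j} → j < value i → ∃ λ k → toℕ k ≡ i × j ≤ toℕ (π ⟨$⟩ k)
  value-attained i j<v with i ℕₚ.<? n
  ... | yes i<n = fromℕ< i<n , Finₚ.toℕ-fromℕ< i<n , ℕ.s≤s⁻¹ j<v

  max-attained : ∀ i {j} → j < max i → ∃ λ k → toℕ k < i × j ≤ toℕ (π ⟨$⟩ k)
  max-attained (suc i) {j} j< with ℕₚ.⊔-sel (max i) (value i)
  ... | inj₁ eq with k , k<i , j≤ ← max-attained i (subst (j <_) eq j<) = k , ℕₚ.m≤n⇒m≤1+n k<i , j≤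
  ... | inj₂ eq with k , refl , j≤ ← value-attained i (subst (j <_) eq j<) = k , ℕₚ.≤-refl , j≤

  max-outside : ∀ {i} → n ≤ i → max (suc i) ≡ max i
  max-outside {i} n≤i = trans (cong (max i ⊔_) (value-outside n≤i)) (ℕₚ.⊔-identityʳ (max i))

  max-jump : ∀ k → max (toℕ k) < max (suc (toℕ k)) → max (suc (toℕ k)) ≡ ⟦ π ⟨$⟩ k ⟧
  max-jump k lt with ℕₚ.⊔-sel (max (toℕ k)) (value (toℕ k))
  ... | inj₁ eq = contradiction lt (ℕₚ.<-irrefl (sym eq))
  ... | inj₂ eq = trans eq (value-toℕ k)

  -- A weak excedance is a left-to-right maximum: an earlier value reaching π(k) would contradict
  -- `weakExc-increasing`.
  weakExc⇒max-jump : ∀ k → k Fin.≤ π ⟨$⟩ k → max (toℕ k) < max (suc (toℕ k))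
  weakExc⇒max-jump k k≤πk = ℕₚ.≤-<-trans (ℕₚ.≮⇒≥ λ πk<max →
      let z , z<k , πk≤πz = max-attained (toℕ k) πk<max in
      ℕₚ.<⇒≱ (weakExc-increasing (perm π) (avoids π) z<k k≤πk) πk≤πz)
    (max-bounds k ℕₚ.≤-refl)

  -- The last of the first i positions is either a weak excedance, whose own value suffices, or lies
  -- under an earlier arc by `covered`.
  i≤max : ∀ {i} → i ≤ n → i ≤ max i
  i≤max {zero}  _   = z≤n
  i≤max {suc i} i<n = subst (λ x → suc x ≤ max (suc x)) (Finₚ.toℕ-fromℕ< i<n)
    (above-diagonal (fromℕ< i<n))
    where
    above-diagonal : ∀ k → toℕ k < max (suc (toℕ k))
    above-diagonal k with k Finₚ.≤? π ⟨$⟩ k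
    ... | yes k≤πk = ℕₚ.≤-<-trans k≤πk (max-bounds k ℕₚ.≤-refl)
    ... | no k≰πk with z , z<k , k≤πz ← covered π {k} (ℕₚ.≰⇒> k≰πk) =
      ℕₚ.≤-<-trans k≤πz (max-bounds z (ℕₚ.m≤n⇒m≤1+n z<k))

  max-n : max n ≡ n
  max-n = ℕₚ.≤-antisym (max-≤ n) (i≤max ℕₚ.≤-refl)

  jump<n : ∀ {i} → max i < max (suc i) → i < n
  jump<n lt = ℕₚ.≰⇒> λ n≤i → ℕₚ.<⇒≢ lt (sym (max-outside n≤i))

  -- At a jump the new maximum is π(k) itself, and `i≤max` keeps it weakly above the diagonal.
  weakExc⇒max-jump⁻ : ∀ k → max (toℕ k) < max (suc (toℕ k)) → k Fin.≤ π ⟨$⟩ k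
  weakExc⇒max-jump⁻ k lt = ℕ.s≤s⁻¹ (subst (suc (toℕ k) ≤_) (max-jump k lt) (i≤max (Finₚ.toℕ<n k)))

  -- Without a jump k is not a weak excedance, so the truncated difference on the left is 0 as well.
  excedance-max : ∀ k → toℕ (π ⟨$⟩ k) ∸ toℕ k ≡
    (max (suc (toℕ k)) ∸ suc (toℕ k) when (max (toℕ k) ℕₚ.<? max (suc (toℕ k))))
  excedance-max k with ℕₚ.<-≤-connex (max (toℕ k)) (max (suc (toℕ k)))
  ... | inj₁ lt = sym (trans (when-yes (_ ℕₚ.<? _) _ lt) (cong (_∸ suc (toℕ k)) (max-jump k lt)))
  ... | inj₂ ge = trans
    (ℕₚ.m≤n⇒m∸n≡0 (ℕₚ.<⇒≤ (ℕₚ.≰⇒> λ k≤πk → ℕₚ.<⇒≱ (weakExc⇒max-jump k k≤πk) ge)))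
    (sym (when-no (_ ℕₚ.<? _) _ (ℕₚ.≤⇒≯ ge)))

open RunningMax using (max; max-jump; max-mono; max-step; max-≤; max-n; max-outside; max-bounds;
  max-attained; i≤max; jump<n; excedance-max; weakExc⇒max-jump; weakExc⇒max-jump⁻)

-- The relation between a permutation and the jumps of another.

record Follows {n} (α β : S321 n) : Set where
  field
    -- `toℕ` counts from 0, so with i = `⟦ k ⟧` the equation says that β(i) is t(i) + 1; since t(i)
    -- ≥ i, this is an excedance.
    jump  : ∀ k → max α ⟦ k ⟧ < max α (suc ⟦ k ⟧) → toℕ (β ⟨$⟩ k) ≡ max α ⟦ k ⟧
    level : ∀ k → k Fin.< β ⟨$⟩ k → max α ⟦ k ⟧ < max α (suc ⟦ k ⟧)

open Follows

excedance-follows : ∀ {n} {α β : S321 n} → Follows α β → ∀ k → toℕ (β ⟨$⟩ k) ∸ toℕ k ≡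
  (suc (max α ⟦ k ⟧) ∸ ⟦ k ⟧ when (max α ⟦ k ⟧ ℕₚ.<? max α (suc ⟦ k ⟧)))
excedance-follows {α = α} f k with ℕₚ.<-≤-connex (max α ⟦ k ⟧) (max α (suc ⟦ k ⟧))
-- Both arguments of the difference on the right are successors, so it reduces to
-- `max α ⟦ k ⟧ ∸ toℕ k`.
... | inj₁ lt = trans (cong (_∸ toℕ k) (jump f k lt)) (sym (when-yes (_ ℕₚ.<? _) _ lt))
... | inj₂ ge = trans
  (ℕₚ.m≤n⇒m∸n≡0 (ℕₚ.≮⇒≥ λ k<βk → ℕₚ.<⇒≱ (level f k k<βk) ge))
  (sym (when-no (_ ℕₚ.<? _) _ (ℕₚ.≤⇒≯ ge)))

-- Parity of the two inversion numbers.

+-swapʳ : ∀ x y z → x + y + z ≡ x + z + y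
+-swapʳ = solve-∀

-- Congruence modulo 2 is carried as an explicit even surplus on the right, which stays in ℕ and
-- accumulates along the induction.
telescope-parity : ∀ (b u : ℕ → ℕ) m →
  (∀ k → k < m → ∃ λ c → u k + b k ≡ u (suc k) + 2 * c) →
  ∃ λ c → u 0 + sum {m} (b ∘ toℕ) ≡ u m + 2 * c
telescope-parity b u zero    _ = 0 , refl
telescope-parity b u (suc m) h
  with c , p ← h 0 (s≤s z≤n)
  with d , q ← telescope-parity (b ∘ suc) (u ∘ suc) m (λ k k<m → h (suc k) (s≤s k<m)) = d + c , (begin
  u 0 + (b 0 + rest)             ≡⟨ ℕₚ.+-assoc (u 0) (b 0) rest ⟨
  u 0 + b 0 + rest               ≡⟨ cong (_+ rest) p ⟩
  u 1 + 2 * c + rest             ≡⟨ +-swapʳ (u 1) (2 * c) rest ⟩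
  u 1 + rest + 2 * c             ≡⟨ cong (_+ 2 * c) q ⟩
  u (suc m) + 2 * d + 2 * c      ≡⟨ collect (u (suc m)) d c ⟩
  u (suc m) + 2 * (d + c)        ∎)
  where
  open ≡-Reasoning
  rest = sum {m} (b ∘ suc ∘ toℕ)
  collect : ∀ x d c → x + 2 * d + 2 * c ≡ x + 2 * (d + c)
  collect = solve-∀

follows-parity : ∀ {n} → n ≥ 1 → (α β : S321 n) → Follows α β →
  ∃ λ c → suc (inv (perm α) + inv (perm β)) ≡ n + 2 * c
follows-parity {n} n≥1 α β f = proj₁ total , (begin
  suc (inv (perm α) + inv (perm β))
    ≡⟨ cong suc (cong₂ _+_ (inv-excedances α) (inv-excedances β)) ⟩
  suc (sum {n} (λ k → toℕ (α ⟨$⟩ k) ∸ toℕ k) + sum {n} (λ k → toℕ (β ⟨$⟩ k) ∸ toℕ k))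
    ≡⟨ cong suc (cong₂ _+_ (sum-cong-≗ {n} (excedance-max α)) (sum-cong-≗ {n} (excedance-follows f))) ⟩
  suc (sum {n} (F ∘ toℕ) + sum {n} (G ∘ suc ∘ toℕ))
    ≡⟨ cong suc (∑-distrib-+ {n} (F ∘ toℕ) (G ∘ suc ∘ toℕ)) ⟨
  1 + sum {n} (λ k → F (toℕ k) + G (suc (toℕ k)))
    -- The leading 1 is `G 0`: the step from t(0) = 0 to t(1) is a jump because n ≥ 1, but it gives
    -- no position of β.
    ≡⟨ cong (_+ sum {n} (λ k → F (toℕ k) + G (suc (toℕ k))))
         (when-yes (0 ℕₚ.<? t 1) 1 (i≤max α n≥1)) ⟨
  u 0 + sum {n} (λ k → F (toℕ k) + G (suc (toℕ k))) ≡⟨ proj₂ total ⟩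
  -- `G n` vanishes because the maximum does not jump at n.
  t n + G n + 2 * proj₁ total                      ≡⟨ cong₂ (λ x y → x + y + 2 * proj₁ total) (max-n α)
    (when-no (_ ℕₚ.<? _) _ (ℕₚ.<-irrefl (sym (max-outside α ℕₚ.≤-refl)))) ⟩
  n + 0 + 2 * proj₁ total                          ≡⟨ cong (_+ 2 * proj₁ total) (ℕₚ.+-identityʳ n) ⟩
  n + 2 * proj₁ total                              ∎)
  where
  open ≡-Reasoning
  t = max α
  F G u : ℕ → ℕ
  F k = t (suc k) ∸ suc k when (t k ℕₚ.<? t (suc k))
  G k = suc (t k) ∸ k when (t k ℕₚ.<? t (suc k))
  -- `F` is summed over 0, ..., n - 1 but `G` over 1, ..., n; including `G k` in the potential
  -- absorbs this shift.
  u k = t k + G k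
  rearrange : ∀ x y z w → x + y + (z + w) ≡ x + (z + y) + w
  rearrange = solve-∀
  jump-sum : ∀ k a b → (k + a) + ((a + b) + suc a) ≡ suc (k + (a + b)) + 2 * a
  jump-sum = solve-∀
  key : ∀ k → k < n → ∃ λ c → t k + (F k + G k) ≡ t (suc k) + 2 * c
  key k k<n with ℕₚ.<-≤-connex (t k) (t (suc k))
  ... | inj₂ ge = 0 , trans
    (cong (t k +_) (cong₂ _+_ (when-no (_ ℕₚ.<? _) _ (ℕₚ.≤⇒≯ ge))
                              (when-no (_ ℕₚ.<? _) _ (ℕₚ.≤⇒≯ ge))))
    (cong (_+ 0) (ℕₚ.≤-antisym (max-step α k) ge))
  -- Write t(k) = k + a and t(k+1) = t(k) + b + 1. The two contributions are a + b and a + 1, which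
  -- exceed the increment b + 1 of t by 2a.
  ... | inj₁ lt = t k ∸ k , (begin
    t k + (F k + G k)
      ≡⟨ cong (t k +_) (cong₂ _+_ (when-yes (_ ℕₚ.<? _) _ lt) (when-yes (_ ℕₚ.<? _) _ lt)) ⟩
    t k + ((t (suc k) ∸ suc k) + (suc (t k) ∸ k))  ≡⟨ cong₂ (λ x y → x + ((y ∸ suc k) + (suc x ∸ k))) tk≡ t1+k≡ ⟩
    k + a + ((k + (a + b) ∸ k) + (suc (k + a) ∸ k)) ≡⟨ cong₂ (λ x y → k + a + (x + y))
       (ℕₚ.m+n∸m≡n k (a + b)) (trans (cong (_∸ k) (sym (ℕₚ.+-suc k a))) (ℕₚ.m+n∸m≡n k (suc a))) ⟩
    k + a + (a + b + suc a)                        ≡⟨ jump-sum k a b ⟩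
    suc (k + (a + b)) + 2 * a                      ≡⟨ cong (_+ 2 * a) t1+k≡ ⟨
    t (suc k) + 2 * a                              ∎)
    where
    a = t k ∸ k
    b = t (suc k) ∸ suc (t k)
    tk≡ : t k ≡ k + a
    tk≡ = sym (ℕₚ.m+[n∸m]≡n (i≤max α (ℕₚ.<⇒≤ k<n)))
    t1+k≡ : t (suc k) ≡ suc (k + (a + b))
    t1+k≡ = trans (sym (ℕₚ.m+[n∸m]≡n lt)) (cong suc (trans (cong (_+ b) tk≡) (ℕₚ.+-assoc k a b)))
  step : ∀ k → k < n → ∃ λ c → u k + (F k + G (suc k)) ≡ u (suc k) + 2 * c
  step k k<n with c , eq ← key k k<n = c , (begin
    t k + G k + (F k + G (suc k))      ≡⟨ rearrange (t k) (G k) (F k) (G (suc k)) ⟩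
    t k + (F k + G k) + G (suc k)      ≡⟨ cong (_+ G (suc k)) eq ⟩
    t (suc k) + 2 * c + G (suc k)      ≡⟨ +-swapʳ (t (suc k)) (2 * c) (G (suc k)) ⟩
    t (suc k) + G (suc k) + 2 * c      ∎)
  total = telescope-parity (λ k → F k + G (suc k)) u n step

-- Rowmotion in terms of the running maximum.

module _ {n} (α : S321 n) where

  ideal⇒< : ∀ I → OrderIdeal (member (Exc α)) I → hi I < max α (lo I)
  ideal⇒< I (J , (k , _ , lo≡ , hi≡) , lo≤ , hi≤) = ℕₚ.≤-<-trans
    (subst (_ ≤_) hi≡ hi≤) (max-bounds α k (subst (_≤ _) lo≡ lo≤))

  -- The position k attaining the maximum is an excedance, since k lies below lo ≤ hi ≤ α(k) when
  -- counted from 0; its interval contains `I`.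
  <⇒ideal : ∀ I → hi I < max α (lo I) → OrderIdeal (member (Exc α)) I
  <⇒ideal I lt with k , k<lo , hi≤αk ← max-attained α (lo I) lt =
    interval ⟦ k ⟧ (toℕ (α ⟨$⟩ k)) (s≤s z≤n) k<αk (ℕₚ.<⇒≤pred (Finₚ.toℕ<n (α ⟨$⟩ k)))
    , (k , s≤s k<αk , refl , refl) , k<lo , hi≤αk
    where k<αk = ℕₚ.<-≤-trans k<lo (ℕₚ.≤-trans (lo≤hi I) hi≤αk)

  -- Minimality is tested against two smaller intervals. Lowering the upper end to t(lo) stays
  -- outside the ideal, which forces hi = t(lo); raising the lower end by 1 must enter the ideal,
  -- which forces a jump.
  ρ𝓐⇒jump : ∀ {I} → member (ρ𝓐 (Exc α)) I →
    hi I ≡ max α (lo I) × max α (lo I) < max α (suc (lo I))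
  ρ𝓐⇒jump {I} (I∉ , minimal) = sym max≡hi , ℕₚ.≰⇒> no-plateau
    where
    max≤hi : max α (lo I) ≤ hi I
    max≤hi = ℕₚ.≮⇒≥ (I∉ ∘ <⇒ideal I)

    initial : Interval n
    initial = interval (lo I) (max α (lo I)) (1≤lo I) (i≤max α (ℕₚ.<⇒≤ (lo<n I)))
      (ℕₚ.≤-trans max≤hi (hi≤n-1 I))

    max≡hi : max α (lo I) ≡ hi I
    max≡hi = cong hi (minimal initial
      (λ J∈ → ℕₚ.<-irrefl refl (ideal⇒< initial J∈)) (ℕₚ.≤-refl , max≤hi))

    -- On a plateau lo + 1 ≤ t(lo + 1) ≤ hi, so the raised interval is nonempty and still outside
    -- the ideal.
    no-plateau : ¬ (max α (suc (lo I)) ≤ max α (lo I))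
    no-plateau max≤ = ℕₚ.1+n≢n (cong lo (minimal final
      (λ J∈ → ℕₚ.<⇒≱ (ideal⇒< final J∈) max≤hi′) (ℕₚ.n≤1+n _ , ℕₚ.≤-refl)))
      where
      max≤hi′ : max α (suc (lo I)) ≤ hi I
      max≤hi′ = ℕₚ.≤-trans max≤ max≤hi
      final : Interval n
      final = interval (suc (lo I)) (hi I) (s≤s z≤n)
        (ℕₚ.≤-trans (i≤max α (lo<n I)) max≤hi′) (hi≤n-1 I)

  -- A non-member J of the ideal below `I` has t(lo J) ≤ hi J ≤ t(lo I). The jump then excludes lo J
  -- > lo I, and monotonicity of t gives hi J ≥ hi I.
  jump⇒ρ𝓐 : ∀ {I} → hi I ≡ max α (lo I) → max α (lo I) < max α (suc (lo I)) →
    member (ρ𝓐 (Exc α)) I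
  jump⇒ρ𝓐 {I} hi≡ lt = (λ I∈ → ℕₚ.<-irrefl hi≡ (ideal⇒< I I∈)) , λ J J∉ (lo≤ , hi≤) →
    let max≤hi = ℕₚ.≮⇒≥ (J∉ ∘ <⇒ideal J) in
    ⊑-antisym {I = J} {I} (lo≤ , hi≤)
      ( ℕₚ.≮⇒≥ (λ lo< → ℕₚ.<⇒≱ lt (ℕₚ.≤-trans (max-mono α lo<)
          (ℕₚ.≤-trans max≤hi (subst (_ ≤_) hi≡ hi≤))))
      , subst (_≤ hi J) (sym hi≡) (ℕₚ.≤-trans (max-mono α lo≤) max≤hi))

  ρ𝓐⇒follows : (β : S321 n) → (∀ {I} → member (Exc β) I → member (ρ𝓐 (Exc α)) I) →
    (∀ {I} → member (ρ𝓐 (Exc α)) I → member (Exc β) I) → Follows α β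
  ρ𝓐⇒follows β to from = record { jump = jump′ ; level = level′ }
    where
    jump′ : ∀ k → max α ⟦ k ⟧ < max α (suc ⟦ k ⟧) → toℕ (β ⟨$⟩ k) ≡ max α ⟦ k ⟧
    -- The upper end t(i) is admissible because t(i) < t(i+1) ≤ n.
    jump′ k lt
      with k′ , _ , lo≡ , hi≡ ← from {interval ⟦ k ⟧ (max α ⟦ k ⟧) (s≤s z≤n)
             (i≤max α (Finₚ.toℕ<n k)) (ℕₚ.<⇒≤pred (ℕₚ.<-≤-trans lt (max-≤ α _)))} (jump⇒ρ𝓐 refl lt)
      with refl ← Finₚ.toℕ-injective (ℕₚ.suc-injective lo≡) = sym hi≡

    level′ : ∀ k → k Fin.< β ⟨$⟩ k → max α ⟦ k ⟧ < max α (suc ⟦ k ⟧)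
    level′ k k<βk = proj₂ (ρ𝓐⇒jump (to
      {interval ⟦ k ⟧ (toℕ (β ⟨$⟩ k)) (s≤s z≤n) k<βk (ℕₚ.<⇒≤pred (Finₚ.toℕ<n (β ⟨$⟩ k)))}
      (k , s≤s k<βk , refl , refl)))

  ρ𝓢-follows : Follows α (ρ𝓢 α)
  ρ𝓢-follows = ρ𝓐⇒follows (Exc⁻.filling (ρ𝓐 (Exc α)))
    (λ {I} → proj₁ (Exc⁻.Exc-filling (ρ𝓐 (Exc α))) {I})
    (λ {I} → proj₂ (Exc⁻.Exc-filling (ρ𝓐 (Exc α))) {I})

-- Staircase paths, their valleys, and the paths `E-p`.

module _ (t : ℕ → ℕ) where

  -- The path whose (i + 1)-st step 𝚍 is at height t (i + 1).
  stairs : ℕ → ℕ → Word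
  stairs zero    i = []
  stairs (suc k) i = replicate (t (suc i) ∸ t i) 𝚞 ++ 𝚍 ∷ stairs k (suc i)

  -- The path is reflected in the diagonal, so that Corner locates the valleys of stairs.
  mirror : ℕ → ℕ → Word
  mirror k i = map swap (stairs k i)

  mirror-suc : ∀ k i → mirror (suc k) i ≡ replicate (t (suc i) ∸ t i) 𝚍 ++ 𝚞 ∷ mirror k (suc i)
  mirror-suc k i = trans (Listₚ.map-++ swap (replicate (t (suc i) ∸ t i) 𝚞) _)
    (cong (_++ 𝚞 ∷ mirror k (suc i)) (Listₚ.map-replicate swap (t (suc i) ∸ t i) 𝚞))

  corner-fall : ∀ r {w a b x y} → Corner w (a + r) b x y → Corner (replicate r 𝚍 ++ w) a b x y
  corner-fall zero    {w} {a} {b} {x} {y} c = subst (λ z → Corner w z b x y) (ℕₚ.+-identityʳ a) c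
  corner-fall (suc r) {w} {a} {b} {x} {y} c =
    skip-𝚍 (corner-fall r (subst (λ z → Corner w z b x y) (ℕₚ.+-suc a r) c))

  corner-fall⁻ : ∀ r {w a b x y} → Corner (replicate r 𝚍 ++ w) a b x y → Corner w (a + r) b x y
  corner-fall⁻ zero    {w} {a} {b} {x} {y} c = subst (λ z → Corner w z b x y) (sym (ℕₚ.+-identityʳ a)) c
  corner-fall⁻ (suc r) {w} {a} {b} {x} {y} (skip-𝚍 c) =
    subst (λ z → Corner w z b x y) (sym (ℕₚ.+-suc a r)) (corner-fall⁻ r c)

  module _ (t-step : ∀ i → t i ≤ t (suc i)) where

    -- The letter 𝚞 in front starts a corner only if the run of 𝚍 behind it is nonempty, that is, if
    -- t jumps there. The induction hypothesis for the remaining path is passed as an argument.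
    after-rise⁻ : ∀ k i {x y} →
      (Corner (mirror k (suc i)) (t (suc i)) (suc i) x y → x ≡ suc (t y) × t y < t (suc y)) →
      Corner (𝚞 ∷ mirror k (suc i)) (t (suc i)) i x y → x ≡ suc (t y) × t y < t (suc y)
    after-rise⁻ zero    i _ (skip-𝚞 ())
    after-rise⁻ (suc k) i {x} {y} later c = go (t (2 + i) ∸ t (suc i)) refl
        (subst (λ w → Corner (𝚞 ∷ w) (t (suc i)) i x y) (mirror-suc k (suc i)) c)
      where
      fold : ∀ {r} → t (2 + i) ∸ t (suc i) ≡ r →
        Corner (replicate r 𝚍 ++ 𝚞 ∷ mirror k (2 + i)) (t (suc i)) (suc i) x y →
        Corner (mirror (suc k) (suc i)) (t (suc i)) (suc i) x y
      fold refl = subst (λ w → Corner w (t (suc i)) (suc i) x y) (sym (mirror-suc k (suc i)))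

      go : ∀ r → t (2 + i) ∸ t (suc i) ≡ r →
        Corner (𝚞 ∷ replicate r 𝚍 ++ 𝚞 ∷ mirror k (2 + i)) (t (suc i)) i x y →
        x ≡ suc (t y) × t y < t (suc y)
      go (suc r) eq here       = refl , ℕₚ.m∸n≢0⇒n<m λ eq′ → contradiction (trans (sym eq) eq′) λ ()
      go zero    eq (skip-𝚞 c) = later (fold eq c)
      go (suc r) eq (skip-𝚞 c) = later (fold eq c)

    mirror-corner⁻ : ∀ k i {x y} → Corner (mirror k i) (t i) i x y →
      x ≡ suc (t y) × t y < t (suc y)
    mirror-corner⁻ (suc k) i {x} {y} c = after-rise⁻ k i (mirror-corner⁻ k (suc i))
      (subst (λ z → Corner (𝚞 ∷ mirror k (suc i)) z i x y) (ℕₚ.m+[n∸m]≡n (t-step i))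
        (corner-fall⁻ (t (suc i) ∸ t i) (subst (λ w → Corner w (t i) i x y) (mirror-suc k i) c)))

    -- The jump puts a 𝚍 directly behind the 𝚞 that ends at height j. The bound j < i + k is strict
    -- because nothing follows the last 𝚞.
    mirror-corner : ∀ k i {j} → i < j → j < i + k → t j < t (suc j) →
      Corner (mirror k i) (t i) i (suc (t j)) j
    mirror-corner zero i i<j j< _ =
      contradiction (subst (_ <_) (ℕₚ.+-identityʳ i) j<) (ℕₚ.<-asym i<j)
    mirror-corner (suc k) i {j} i<j j< lt =
      subst (λ w → Corner w (t i) i (suc (t j)) j) (sym (mirror-suc k i))
        (corner-fall (t (suc i) ∸ t i) (subst (λ z → Corner (𝚞 ∷ mirror k (suc i)) z i (suc (t j)) j)
          (sym (ℕₚ.m+[n∸m]≡n (t-step i))) (after-rise k j<′)))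
      where
      j<′ : j < suc i + k
      j<′ = subst (j <_) (ℕₚ.+-suc i k) j<
      after-rise : ∀ k → j < suc i + k → Corner (𝚞 ∷ mirror k (suc i)) (t (suc i)) i (suc (t j)) j
      after-rise k j< with ℕₚ.m≤n⇒m<n∨m≡n i<j
      after-rise k j<       | inj₁ 1+i<j = skip-𝚞 (mirror-corner k (suc i) 1+i<j j< lt)
      after-rise zero j<    | inj₂ refl  = contradiction j< (ℕₚ.<-irrefl (sym (ℕₚ.+-identityʳ j)))
      after-rise (suc k) j< | inj₂ refl  = subst
        (λ w → Corner (𝚞 ∷ w) (t j) i (suc (t j)) j) (sym (mirror-suc k j))
        (peak (t (suc j) ∸ t j) (ℕₚ.m>n⇒m∸n≢0 lt))
        where
        peak : ∀ r {w} → r ≢ 0 → Corner (𝚞 ∷ replicate r 𝚍 ++ w) (t j) i (suc (t j)) j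
        peak zero    r≢0 = contradiction refl r≢0
        peak (suc r) _   = here

-- Both words spend one 𝚍 per column, and `build` rises exactly at the weak excedances, which are
-- the jumps of the running maximum.
E-p-stairs : ∀ {n} (α : S321 n) → word (E-p α) ≡ stairs (max α) n 0
E-p-stairs {n} α = build≡ n 0 0 (ℕₚ.+-identityʳ n) refl
  where
  open WeakExc α
  t = max α

  R⇒jump : ∀ {i j} → R i j → t i < t (suc i) × t (suc i) ≡ suc j
  R⇒jump (k , refl , refl , k≤αk) = lt , max-jump α k lt
    where lt = weakExc⇒max-jump α k k≤αk

  jump⇒R : ∀ {i} → i < n → t i < t (suc i) → ∃ (R i)
  jump⇒R i<n lt = _ , k , sym i≡ , refl ,
    weakExc⇒max-jump⁻ α k (subst (λ i → t i < t (suc i)) (sym i≡) lt)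
    where
    k  = fromℕ< i<n
    i≡ = Finₚ.toℕ-fromℕ< i<n

  build≡ : ∀ k i b → k + i ≡ n → b ≡ t i → build k i b ≡ stairs t k i
  -- The closing rise of `build` is empty because t(n) = n.
  build≡ zero    i b refl refl = cong (λ r → rise r [])
    (trans (cong (i ∸_) (max-n α)) (ℕₚ.n∸n≡0 i))
  build≡ (suc k) i b eq b≡ with R? i
  ... | yes (j , r) with lt , t≡ ← R⇒jump r = cong₂ (λ r w → replicate r 𝚞 ++ 𝚍 ∷ w)
    (trans (sym (ℕₚ.+-∸-assoc 1 (ℕ.s≤s⁻¹ (subst₂ _<_ (sym b≡) t≡ lt)))) (cong₂ _∸_ (sym t≡) b≡))
    (build≡ k (suc i) (suc j) (trans (ℕₚ.+-suc k i) eq) (sym t≡))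
  ... | no ¬r = cong₂ (λ r w → replicate r 𝚞 ++ 𝚍 ∷ w)
    (sym (ℕₚ.m≤n⇒m∸n≡0 level≥))
    (build≡ k (suc i) b (trans (ℕₚ.+-suc k i) eq) (trans b≡ (ℕₚ.≤-antisym (max-step α i) level≥)))
    where level≥ = ℕₚ.≮⇒≥ λ lt → ¬r (jump⇒R (subst (i <_) eq (s≤s (ℕₚ.m≤n+m i k))) lt)

-- The Lalanne-Kreweras involution and the inverse permutation.

flip : ∀ {n} → S321 n → S321 n
flip π = Perm.flip (perm π) avoiding Avoids321-inverse (perm π) (avoids π)

-- The valleys of `D-v π` are the excedance cells of π⁻¹ with coordinates exchanged; reading the
-- same word as the staircase of σ places them at the jumps of its running maximum.
E-p≡D-v⇒follows : ∀ {n} (σ π : S321 n) → word (E-p σ) ≡ word (D-v π) → Follows σ (flip π)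
E-p≡D-v⇒follows {n} σ π eq = record { jump = jump′ ; level = level′ }
  where
  t = max σ

  swap-word : map swap (word (D-v π)) ≡ mirror t n 0
  swap-word = cong (map swap) (trans (sym eq) (E-p-stairs σ))

  jump′ : ∀ k → t ⟦ k ⟧ < t (suc ⟦ k ⟧) → toℕ (flip π ⟨$⟩ k) ≡ t ⟦ k ⟧
  jump′ k lt
    with x , x≡ , k≡ , _ ← Equivalence.to (D-v-valleys π _ _)
           (subst (λ w → ValleyBelow w (suc (t ⟦ k ⟧)) ⟦ k ⟧) (swap-involutive (word (D-v π)))
             (PeakAbove⇒ValleyBelow (Corner⇒PeakAbove
               (subst (λ w → Corner w 0 0 (suc (t ⟦ k ⟧)) ⟦ k ⟧) (sym swap-word)
                 (mirror-corner t (max-step σ) n 0 (s≤s z≤n) (jump<n σ lt) lt)))))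
    with refl ← Finₚ.toℕ-injective (ℕₚ.suc-injective k≡) =
      trans (cong toℕ (Perm.inverseˡ (perm π))) (sym (ℕₚ.suc-injective x≡))

  level′ : ∀ k → k Fin.< flip π ⟨$⟩ k → t ⟦ k ⟧ < t (suc ⟦ k ⟧)
  level′ k k<x = proj₂ (mirror-corner⁻ t (max-step σ) n 0
    (subst (λ w → Corner w 0 0 ⟦ flip π ⟨$⟩ k ⟧ ⟦ k ⟧) swap-word
      (PeakAbove⇒Corner (ValleyBelow⇒PeakAbove (Equivalence.from (D-v-valleys π _ _)
        (flip π ⟨$⟩ k , refl , cong ⟦_⟧ (sym (Perm.inverseʳ (perm π)))
        , subst (λ y → ⟦ y ⟧ < ⟦ flip π ⟨$⟩ k ⟧) (sym (Perm.inverseʳ (perm π))) (s≤s k<x)))))))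

-- From parity to signs.

-1^2* : ∀ c → -1ℤ ℤ.^ (2 * c) ≡ ℤ.1ℤ
-1^2* c = trans (sym (ℤₚ.^-*-assoc -1ℤ 2 c)) (ℤₚ.^-zeroˡ c)

-1^n*-1^n : ∀ n → -1ℤ ℤ.^ n ℤ.* -1ℤ ℤ.^ n ≡ ℤ.1ℤ
-1^n*-1^n n = trans (sym (ℤₚ.^-distribˡ-+-* -1ℤ n n))
  (trans (cong (λ m → -1ℤ ℤ.^ (n + m)) (sym (ℕₚ.+-identityʳ n))) (-1^2* n))

-- Signs square to 1, so the sign of b is the product of the signs of a and a + b, and the latter is
-- minus the sign of a + b + 1.
sign-parity : ∀ n a b → (∃ λ c → suc (a + b) ≡ n + 2 * c) →
  -1ℤ ℤ.^ b ≡ - (-1ℤ ℤ.^ n ℤ.* -1ℤ ℤ.^ a)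
sign-parity n a b (c , eq) = begin
  s b                        ≡⟨ ℤₚ.*-identityˡ (s b) ⟨
  ℤ.1ℤ ℤ.* s b               ≡⟨ cong (ℤ._* s b) (-1^n*-1^n a) ⟨
  s a ℤ.* s a ℤ.* s b        ≡⟨ ℤₚ.*-assoc (s a) (s a) (s b) ⟩
  s a ℤ.* (s a ℤ.* s b)      ≡⟨ cong (s a ℤ.*_) (ℤₚ.^-distribˡ-+-* -1ℤ a b) ⟨
  s a ℤ.* s (a + b)          ≡⟨ cong (s a ℤ.*_) (ℤₚ.neg-involutive (s (a + b))) ⟨
  s a ℤ.* - - s (a + b)      ≡⟨ cong (λ x → s a ℤ.* - x) (ℤₚ.-1*i≡-i (s (a + b))) ⟨
  s a ℤ.* - s (suc (a + b))  ≡⟨ cong (λ x → s a ℤ.* - s x) eq ⟩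
  s a ℤ.* - s (n + 2 * c)    ≡⟨ cong (λ x → s a ℤ.* - x) (ℤₚ.^-distribˡ-+-* -1ℤ n (2 * c)) ⟩
  s a ℤ.* - (s n ℤ.* s (2 * c)) ≡⟨ cong (λ x → s a ℤ.* - (s n ℤ.* x)) (-1^2* c) ⟩
  s a ℤ.* - (s n ℤ.* ℤ.1ℤ)   ≡⟨ cong (λ x → s a ℤ.* - x) (ℤₚ.*-identityʳ (s n)) ⟩
  s a ℤ.* - s n              ≡⟨ ℤₚ.neg-distribʳ-* (s a) (s n) ⟨
  - (s a ℤ.* s n)            ≡⟨ cong -_ (ℤₚ.*-comm (s a) (s n)) ⟩
  - (s n ℤ.* s a)            ∎
  where
  open ≡-Reasoning
  s : ℕ → ℤ
  s = -1ℤ ℤ.^_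

sgn-follows : ∀ {n} → n ≥ 1 → {α β : S321 n} → Follows α β →
  sgn β ≡ - (-1ℤ ℤ.^ n ℤ.* sgn α)
sgn-follows {n} n≥1 {α} {β} f = sign-parity n (inv (perm α)) (inv (perm β)) (follows-parity n≥1 α β f)

-- Here the known permutation enters through its inverse as the follower, so the roles in
-- `sign-parity` are exchanged; passing to the inverse preserves the inversion number.
sgn-flip-follows : ∀ {n} → n ≥ 1 → {α β γ : S321 n} → (∀ i → β ⟨$⟩ i ≡ γ ⟨$⟩ i) →
  Follows α (flip β) → sgn α ≡ - (-1ℤ ℤ.^ n ℤ.* sgn γ)
sgn-flip-follows {n} n≥1 {α} {β} {γ} β≡γ f =
  sign-parity n (inv (perm γ)) (inv (perm α)) (proj₁ parity , (begin
  suc (inv (perm γ) + inv (perm α))           ≡⟨ cong suc (ℕₚ.+-comm (inv (perm γ)) (inv (perm α))) ⟩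
  suc (inv (perm α) + inv (perm γ))
    ≡⟨ cong (λ x → suc (inv (perm α) + x)) (trans (inv-flip (perm β)) (inv-cong β γ β≡γ)) ⟨
  suc (inv (perm α) + inv (perm (flip β)))    ≡⟨ proj₂ parity ⟩
  n + 2 * proj₁ parity                        ∎))
  where
  open ≡-Reasoning
  parity = follows-parity n≥1 α (flip β) f

-1^even : ∀ {n} → 2 ∣ n → -1ℤ ℤ.^ n ≡ ℤ.1ℤ
-1^even (divides c eq) = trans (cong (-1ℤ ℤ.^_) (trans eq (ℕₚ.*-comm c 2))) (-1^2* c)

-1^odd : ∀ {n} → 2 ∤ n → -1ℤ ℤ.^ n ≡ -1ℤ
-1^odd {zero}        2∤n = contradiction (divides 0 refl) 2∤n
-1^odd {suc zero}    2∤n = refl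
-1^odd {suc (suc n)} 2∤n = trans (ℤₚ.^-distribˡ-+-* -1ℤ 2 n) (trans (ℤₚ.*-identityˡ _)
  (-1^odd λ 2∣n → 2∤n (∣m∣n⇒∣m+n (divides 1 refl) 2∣n)))

theorem4p5 : ∀ (n : ℕ) → n ≥ 1 → (π : S321 n) →
    sgn (ρ𝓢 π) ≡ sgn (LK𝓢 π) ×
    (2 ∤ n → sgn (LK𝓢 π) ≡ sgn π) ×
    (2 ∣ n → sgn (LK𝓢 π) ≡ - sgn π)
theorem4p5 n n≥1 π = trans sgn-ρ (sym sgn-LK)
  , (λ 2∤n → trans sgn-LK (trans (cong (λ x → - (x ℤ.* sgn π)) (-1^odd 2∤n))
      (trans (cong -_ (ℤₚ.-1*i≡-i (sgn π))) (ℤₚ.neg-involutive (sgn π)))))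
  , (λ 2∣n → trans sgn-LK (trans (cong (λ x → - (x ℤ.* sgn π)) (-1^even 2∣n))
      (cong -_ (ℤₚ.*-identityˡ (sgn π)))))
  where
  sgn-ρ : sgn (ρ𝓢 π) ≡ - (-1ℤ ℤ.^ n ℤ.* sgn π)
  sgn-ρ = sgn-follows n≥1 {π} {ρ𝓢 π} (ρ𝓢-follows π)

  sgn-LK : sgn (LK𝓢 π) ≡ - (-1ℤ ℤ.^ n ℤ.* sgn π)
  -- `LK𝓢 π` applies `D-v` to `E-p⁻¹ (E-p π)`, which agrees with π pointwise because both have the
  -- same `E-p` path.
  sgn-LK = sgn-flip-follows n≥1 {LK𝓢 π} {E-p⁻¹ (E-p π)} {π}
    (E-p-injective (E-p⁻¹ (E-p π)) π (E-p∘E-p⁻¹ (E-p π)))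
    (E-p≡D-v⇒follows (LK𝓢 π) (E-p⁻¹ (E-p π)) (E-p∘E-p⁻¹ (LK (E-p π))))
    where E-p∘E-p⁻¹ = Inverse.strictlyInverseˡ (E-p-bijection n)
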